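{- Let $\varepsilon_1,\varepsilon_2\in(0,+\infty)$. The unit distance graphs of the strips $\mathbb{R}\times[0,\varepsilon_1]$ and $\mathbb{R}\times[0,\varepsilon_2]$ (with the standard Euclidean metric of $\mathbb{R}^2$) are isomorphic as graphs if and only if $\varepsilon_1=\varepsilon_2$.
   Context: The unit distance graph of a set $V$ in a metric space is the graph with vertex set $V$ in which two vertices are joined by an edge if and only if the distance between them is exactly $1$. -}

module Defs where

open import Level using (0ℓ; _⊔_) renaming (suc to lsuc)
open import Data.Nat.Base as ℕ using (ℕ)
import Data.Integer.Base as ℤ
import Data.Nat.Properties as ℕ
open import Data.Product using (Σ; ∃-syntax; _×_; _,_; proj₁; proj₂)
open import Data.Rational.Base as ℚ using (ℚ; 0ℚ; 1ℚ; ½; ∣_∣)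
import Data.Rational.Properties as ℚ
open import Data.Rational.Solver using (module +-*-Solver)
open import Function.Bundles using (Inverse; _⇔_)
open import Relation.Binary.Bundles using (Setoid)
open import Relation.Binary.Core using (Rel)
open import Relation.Binary.Definitions
  using (Irreflexive; Symmetric; _Respects₂_)
open import Relation.Binary.PropositionalEquality
  using (_≡_; refl; sym; trans; cong; subst)
import Relation.Binary.Construct.On as On
open import Relation.Nullary.Negation.Core using (¬_)
open import Relation.Unary using (Pred)

------------------------------------------------------------------------
-- Rational arithmetic

private

  ε/2 : ∀ {ε} → 0ℚ ℚ.< ε → 0ℚ ℚ.< ½ ℚ.* ε
  ε/2 = ℚ.*-monoʳ-<-pos ½

  halves : ∀ ε → ½ ℚ.* ε ℚ.+ ½ ℚ.* ε ≡ ε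
  halves ε = trans (sym (ℚ.*-distribʳ-+ ε ½ ½)) (ℚ.*-identityˡ ε)

  ∣p-q∣≡∣q-p∣ : ∀ p q → ∣ p ℚ.- q ∣ ≡ ∣ q ℚ.- p ∣
  ∣p-q∣≡∣q-p∣ p q = trans (cong ∣_∣ lemma) (ℚ.∣-p∣≡∣p∣ (q ℚ.- p))
    where
    open +-*-Solver
    lemma : p ℚ.- q ≡ ℚ.- (q ℚ.- p)
    lemma = solve 2 (λ p q → p :- q := :- (q :- p)) refl p q

  ∣p+q∣<ε : ∀ {p q ε} → ∣ p ∣ ℚ.< ½ ℚ.* ε → ∣ q ∣ ℚ.< ½ ℚ.* ε →
            ∣ p ℚ.+ q ∣ ℚ.< ε
  ∣p+q∣<ε {p} {q} {ε} p< q< = subst (∣ p ℚ.+ q ∣ ℚ.<_) (halves ε)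
    (ℚ.≤-<-trans (ℚ.∣p+q∣≤∣p∣+∣q∣ p q) (ℚ.+-mono-< p< q<))

  ∣p-r∣<ε : ∀ {p q r ε} → ∣ p ℚ.- q ∣ ℚ.< ½ ℚ.* ε → ∣ q ℚ.- r ∣ ℚ.< ½ ℚ.* ε →
            ∣ p ℚ.- r ∣ ℚ.< ε
  ∣p-r∣<ε {p} {q} {r} {ε} p< q< =
    subst (λ t → ∣ t ∣ ℚ.< ε) lemma
      (∣p+q∣<ε {p ℚ.- q} {q ℚ.- r} p< q<)
    where
    open +-*-Solver
    lemma : (p ℚ.- q) ℚ.+ (q ℚ.- r) ≡ p ℚ.- r
    lemma = solve 3 (λ p q r → (p :- q) :+ (q :- r) := p :- r) refl p q r

  ∣sum-diff∣<ε : ∀ {p q p′ q′ ε} →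
                 ∣ p ℚ.- p′ ∣ ℚ.< ½ ℚ.* ε → ∣ q ℚ.- q′ ∣ ℚ.< ½ ℚ.* ε →
                 ∣ (p ℚ.+ q) ℚ.- (p′ ℚ.+ q′) ∣ ℚ.< ε
  ∣sum-diff∣<ε {p} {q} {p′} {q′} {ε} p< q< =
    subst (λ t → ∣ t ∣ ℚ.< ε) lemma
      (∣p+q∣<ε {p ℚ.- p′} {q ℚ.- q′} p< q<)
    where
    open +-*-Solver
    lemma : (p ℚ.- p′) ℚ.+ (q ℚ.- q′) ≡ (p ℚ.+ q) ℚ.- (p′ ℚ.+ q′)
    lemma = solve 4 (λ p q p′ q′ →
      (p :- p′) :+ (q :- q′) := (p :+ q) :- (p′ :+ q′)) refl p q p′ q′

  ∣neg-diff∣ : ∀ p q → ∣ (ℚ.- p) ℚ.- (ℚ.- q) ∣ ≡ ∣ p ℚ.- q ∣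
  ∣neg-diff∣ p q = trans (cong ∣_∣ lemma) (∣p-q∣≡∣q-p∣ q p)
    where
    open +-*-Solver
    lemma : (ℚ.- p) ℚ.- (ℚ.- q) ≡ q ℚ.- p
    lemma = solve 2 (λ p q → (:- p) :- (:- q) := q :- p) refl p q

  shrink : ∀ {B ε} → 0ℚ ℚ.< B → 0ℚ ℚ.< ε →
           ∃[ δ ] 0ℚ ℚ.< δ × B ℚ.* δ ≡ ½ ℚ.* ε
  shrink {B} {ε} 0<B 0<ε = δ , 0<δ , Bδ≡
    where
    instance
      B-pos : ℚ.Positive B
      B-pos = ℚ.positive 0<B
      B-nz : ℚ.NonZero B
      B-nz = ℚ.pos⇒nonZero B
      1/B-pos : ℚ.Positive (ℚ.1/ B)
      1/B-pos = ℚ.1/pos⇒pos B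
    δ : ℚ
    δ = ℚ.1/ B ℚ.* (½ ℚ.* ε)
    0<δ : 0ℚ ℚ.< δ
    0<δ = subst (ℚ._< δ) (ℚ.*-zeroʳ (ℚ.1/ B)) (ℚ.*-monoʳ-<-pos (ℚ.1/ B) (ε/2 0<ε))
    Bδ≡ : B ℚ.* δ ≡ ½ ℚ.* ε
    Bδ≡ = trans (sym (ℚ.*-assoc B (ℚ.1/ B) (½ ℚ.* ε)))
          (trans (cong (ℚ._* (½ ℚ.* ε)) (ℚ.*-inverseʳ B))
                 (ℚ.*-identityˡ (½ ℚ.* ε)))

  ∣pq∣<η : ∀ {p q B δ η} → 0ℚ ℚ.< B → B ℚ.* δ ≡ η →
           ∣ p ∣ ℚ.< B → ∣ q ∣ ℚ.< δ → ∣ p ℚ.* q ∣ ℚ.< η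
  ∣pq∣<η {p} {q} {B} {δ} 0<B refl p<B q<δ =
    subst (ℚ._< B ℚ.* δ) (sym (ℚ.∣p*q∣≡∣p∣*∣q∣ p q))
      (ℚ.≤-<-trans
        (ℚ.*-monoʳ-≤-nonNeg ∣ q ∣ {{ℚ.∣-∣-nonNeg q}} (ℚ.<⇒≤ p<B))
        (ℚ.*-monoʳ-<-pos B {{ℚ.positive 0<B}} q<δ))

  ∣product-diff∣<ε : ∀ {p q p′ q′ B C δ₁ δ₂ ε} → 0ℚ ℚ.< B → 0ℚ ℚ.< C →
    B ℚ.* δ₁ ≡ ½ ℚ.* ε → C ℚ.* δ₂ ≡ ½ ℚ.* ε →
    ∣ p ∣ ℚ.< B → ∣ q′ ∣ ℚ.< C → ∣ q ℚ.- q′ ∣ ℚ.< δ₁ → ∣ p ℚ.- p′ ∣ ℚ.< δ₂ →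
    ∣ (p ℚ.* q) ℚ.- (p′ ℚ.* q′) ∣ ℚ.< ε
  ∣product-diff∣<ε {p} {q} {p′} {q′} {ε = ε} 0<B 0<C Bδ Cδ p<B q′<C dq dp =
    subst (λ t → ∣ t ∣ ℚ.< ε) lemma
      (∣p+q∣<ε {p ℚ.* (q ℚ.- q′)} {q′ ℚ.* (p ℚ.- p′)}
        (∣pq∣<η {p} {q ℚ.- q′} 0<B Bδ p<B dq)
        (∣pq∣<η {q′} {p ℚ.- p′} 0<C Cδ q′<C dp))
    where
    open +-*-Solver
    lemma : p ℚ.* (q ℚ.- q′) ℚ.+ q′ ℚ.* (p ℚ.- p′) ≡ (p ℚ.* q) ℚ.- (p′ ℚ.* q′)
    lemma = solve 4 (λ p q p′ q′ →
      p :* (q :- q′) :+ q′ :* (p :- p′) := (p :* q) :- (p′ :* q′)) refl p q p′ q′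

------------------------------------------------------------------------
-- Real numbers: Cauchy sequences of rationals, taken up to _≃_

IsCauchy : (ℕ → ℚ) → Set
IsCauchy x = ∀ ε → 0ℚ ℚ.< ε →
  ∃[ N ] ∀ m n → N ℕ.≤ m → N ℕ.≤ n → ∣ x m ℚ.- x n ∣ ℚ.< ε

record ℝ : Set where
  constructor mkℝ
  field
    seq    : ℕ → ℚ
    cauchy : IsCauchy seq

open ℝ public

Eventually : Pred ℕ 0ℓ → Set
Eventually P = ∃[ N ] ∀ n → N ℕ.≤ n → P n

infix 4 _≃_ _≤_ _<_

_≃_ _≤_ _<_ : Rel ℝ 0ℓ
x ≃ y = ∀ ε → 0ℚ ℚ.< ε → Eventually λ n → ∣ seq x n ℚ.- seq y n ∣ ℚ.< ε
x ≤ y = ∀ ε → 0ℚ ℚ.< ε → Eventually λ n → seq x n ℚ.< seq y n ℚ.+ ε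
x < y = ∃[ ε ] 0ℚ ℚ.< ε × Eventually λ n → seq x n ℚ.+ ε ℚ.< seq y n

private

  infixr 2 _&_

  _&_ : ∀ {P Q} → Eventually P → Eventually Q → Eventually (λ n → P n × Q n)
  (M , p) & (N , q) = M ℕ.⊔ N , λ n le →
    p n (ℕ.m⊔n≤o⇒m≤o M N le) , q n (ℕ.m⊔n≤o⇒n≤o M N le)

  map : ∀ {P Q : Pred ℕ 0ℓ} → (∀ n → P n → Q n) → Eventually P → Eventually Q
  map f (N , p) = N , λ n le → f n (p n le)

  bounded : ∀ x → ∃[ B ] 0ℚ ℚ.< B × Eventually λ n → ∣ seq x n ∣ ℚ.< B
  bounded (mkℝ x c) with c 1ℚ (ℚ.positive⁻¹ 1ℚ)
  ... | N , near = B , 0<B , N , below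
    where
    open +-*-Solver
    B : ℚ
    B = 1ℚ ℚ.+ ∣ x N ∣
    0<B : 0ℚ ℚ.< B
    0<B = ℚ.+-mono-<-≤ (ℚ.positive⁻¹ 1ℚ) (ℚ.0≤∣p∣ (x N))
    split : ∀ p q → (p ℚ.- q) ℚ.+ q ≡ p
    split = solve 2 (λ p q → (p :- q) :+ q := p) refl
    below : ∀ n → N ℕ.≤ n → ∣ x n ∣ ℚ.< B
    below n N≤n = subst (λ t → ∣ t ∣ ℚ.< B) (split (x n) (x N))
      (ℚ.≤-<-trans (ℚ.∣p+q∣≤∣p∣+∣q∣ (x n ℚ.- x N) (x N))
        (ℚ.+-monoˡ-< ∣ x N ∣ (near n N N≤n ℕ.≤-refl)))

fromℚ : ℚ → ℝ
fromℚ q = mkℝ (λ _ → q) λ ε 0<ε → 0 , λ _ _ _ _ →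
  subst (ℚ._< ε) (cong ∣_∣ (sym (ℚ.+-inverseʳ q))) 0<ε

0ℝ 1ℝ : ℝ
0ℝ = fromℚ 0ℚ
1ℝ = fromℚ 1ℚ

infixl 6 _+_ _-_
infixl 7 _*_
infix  8 -_

_+_ : ℝ → ℝ → ℝ
x + y = mkℝ (λ n → seq x n ℚ.+ seq y n) λ ε 0<ε →
  let M , p = cauchy x (½ ℚ.* ε) (ε/2 0<ε)
      N , q = cauchy y (½ ℚ.* ε) (ε/2 0<ε)
  in M ℕ.⊔ N , λ m n m≥ n≥ →
     ∣sum-diff∣<ε {seq x m} {seq y m} {seq x n} {seq y n}
       (p m n (ℕ.m⊔n≤o⇒m≤o M N m≥) (ℕ.m⊔n≤o⇒m≤o M N n≥))
       (q m n (ℕ.m⊔n≤o⇒n≤o M N m≥) (ℕ.m⊔n≤o⇒n≤o M N n≥))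

-_ : ℝ → ℝ
- x = mkℝ (λ n → ℚ.- seq x n) λ ε 0<ε →
  let N , p = cauchy x ε 0<ε
  in N , λ m n m≥ n≥ →
     subst (ℚ._< ε) (sym (∣neg-diff∣ (seq x m) (seq x n))) (p m n m≥ n≥)

_-_ : ℝ → ℝ → ℝ
x - y = x + (- y)

_*_ : ℝ → ℝ → ℝ
x * y = mkℝ (λ n → seq x n ℚ.* seq y n) λ ε 0<ε →
  let B , 0<B , bx = bounded x
      C , 0<C , by = bounded y
      δ₁ , 0<δ₁ , Bδ = shrink 0<B 0<ε
      δ₂ , 0<δ₂ , Cδ = shrink 0<C 0<ε
      K , bxy = bx & by
      M , p = cauchy x δ₂ 0<δ₂
      N , q = cauchy y δ₁ 0<δ₁
      L = M ℕ.⊔ N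
  in K ℕ.⊔ L , λ m n m≥ n≥ →
     let m≥L = ℕ.m⊔n≤o⇒n≤o K L m≥
         n≥L = ℕ.m⊔n≤o⇒n≤o K L n≥
     in ∣product-diff∣<ε {seq x m} {seq y m} {seq x n} {seq y n} 0<B 0<C Bδ Cδ
          (proj₁ (bxy m (ℕ.m⊔n≤o⇒m≤o K L m≥)))
          (proj₂ (bxy n (ℕ.m⊔n≤o⇒m≤o K L n≥)))
          (q m n (ℕ.m⊔n≤o⇒n≤o M N m≥L) (ℕ.m⊔n≤o⇒n≤o M N n≥L))
          (p m n (ℕ.m⊔n≤o⇒m≤o M N m≥L) (ℕ.m⊔n≤o⇒m≤o M N n≥L))

pointwise : ∀ {x y} → (∀ n → seq x n ≡ seq y n) → x ≃ y
pointwise {x} {y} eq ε 0<ε = 0 , λ n _ →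
  subst (ℚ._< ε)
    (cong ∣_∣ (sym (trans (cong (ℚ._- seq y n) (eq n)) (ℚ.+-inverseʳ (seq y n)))))
    0<ε

≃-refl : ∀ {x} → x ≃ x
≃-refl {x} = pointwise {x} {x} (λ _ → refl)

≃-sym : ∀ {x y} → x ≃ y → y ≃ x
≃-sym {x} {y} x≃y ε 0<ε =
  map (λ n → subst (ℚ._< ε) (∣p-q∣≡∣q-p∣ (seq x n) (seq y n))) (x≃y ε 0<ε)

≃-trans : ∀ {x y z} → x ≃ y → y ≃ z → x ≃ z
≃-trans {x} {y} {z} x≃y y≃z ε 0<ε =
  map (λ n (p , q) → ∣p-r∣<ε {seq x n} {seq y n} {seq z n} p q)
    (x≃y _ (ε/2 0<ε) & y≃z _ (ε/2 0<ε))

+-cong : ∀ {x x′ y y′} → x ≃ x′ → y ≃ y′ → x + y ≃ x′ + y′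
+-cong {x} {x′} {y} {y′} x≃x′ y≃y′ ε 0<ε =
  map (λ n (p , q) → ∣sum-diff∣<ε {seq x n} {seq y n} {seq x′ n} {seq y′ n} p q)
    (x≃x′ _ (ε/2 0<ε) & y≃y′ _ (ε/2 0<ε))

-‿cong : ∀ {x y} → x ≃ y → - x ≃ - y
-‿cong {x} {y} x≃y ε 0<ε =
  map (λ n → subst (ℚ._< ε) (sym (∣neg-diff∣ (seq x n) (seq y n)))) (x≃y ε 0<ε)

*-cong : ∀ {x x′ y y′} → x ≃ x′ → y ≃ y′ → x * y ≃ x′ * y′
*-cong {x} {x′} {y} {y′} x≃x′ y≃y′ ε 0<ε =
  let B , 0<B , bx = bounded x
      C , 0<C , by′ = bounded y′
      δ₁ , 0<δ₁ , Bδ = shrink 0<B 0<ε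
      δ₂ , 0<δ₂ , Cδ = shrink 0<C 0<ε
  in map (λ n (b , c , dy , dx) →
            ∣product-diff∣<ε {seq x n} {seq y n} {seq x′ n} {seq y′ n}
              0<B 0<C Bδ Cδ b c dy dx)
       (bx & by′ & y≃y′ δ₁ 0<δ₁ & x≃x′ δ₂ 0<δ₂)

------------------------------------------------------------------------
-- The Euclidean plane

infix 4 _≈²_

ℝ² : Set
ℝ² = ℝ × ℝ

_≈²_ : Rel ℝ² 0ℓ
(x , y) ≈² (x′ , y′) = x ≃ x′ × y ≃ y′

ℝ²-setoid : Setoid 0ℓ 0ℓ
ℝ²-setoid = record
  { Carrier       = ℝ²
  ; _≈_           = _≈²_
  ; isEquivalence = record
    { refl  = λ { {x , y} → ≃-refl {x} , ≃-refl {y} }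
    ; sym   = λ { {x , y} {x′ , y′} (p , q) →
                  ≃-sym {x} {x′} p , ≃-sym {y} {y′} q }
    ; trans = λ { {x , y} {x′ , y′} {x″ , y″} (p , q) (p′ , q′) →
                  ≃-trans {x} {x′} {x″} p p′ , ≃-trans {y} {y′} {y″} q q′ }
    }
  }

_IsSqrtOf_ : Rel ℝ 0ℓ
r IsSqrtOf x = 0ℝ ≤ r × r * r ≃ x

Δ² : ℝ² → ℝ² → ℝ
Δ² (x , y) (x′ , y′) = (x - x′) * (x - x′) + (y - y′) * (y - y′)

-- The Euclidean metric √((x - x′)² + (y - y′)²), given by its graph.
Distance : ℝ² → ℝ² → ℝ → Set
Distance p q d = d IsSqrtOf Δ² p q

private

  Δ²-cong : ∀ {p p′ q q′} → p ≈² p′ → q ≈² q′ → Δ² p q ≃ Δ² p′ q′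
  Δ²-cong {a , b} {a′ , b′} {c , d} {c′ , d′} (a≃ , b≃) (c≃ , d≃) =
    +-cong {(a - c) * (a - c)} {(a′ - c′) * (a′ - c′)}
           {(b - d) * (b - d)} {(b′ - d′) * (b′ - d′)}
      (*-cong {a - c} {a′ - c′} {a - c} {a′ - c′} ac ac)
      (*-cong {b - d} {b′ - d′} {b - d} {b′ - d′} bd bd)
    where
    ac : a - c ≃ a′ - c′
    ac = +-cong {a} {a′} { - c} { - c′} a≃ (-‿cong {c} {c′} c≃)
    bd : b - d ≃ b′ - d′
    bd = +-cong {b} {b′} { - d} { - d′} b≃ (-‿cong {d} {d′} d≃)

  Δ²-sym : ∀ p q → Δ² p q ≃ Δ² q p
  Δ²-sym (a , b) (c , d) = pointwise {Δ² (a , b) (c , d)} {Δ² (c , d) (a , b)} λ n →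
    solve 4 (λ a b c d →
      (a :- c) :* (a :- c) :+ (b :- d) :* (b :- d) :=
      (c :- a) :* (c :- a) :+ (d :- b) :* (d :- b))
      refl (seq a n) (seq b n) (seq c n) (seq d n)
    where open +-*-Solver

  Δ²-self : ∀ p → Δ² p p ≃ 0ℝ
  Δ²-self (a , b) = pointwise {Δ² (a , b) (a , b)} {0ℝ} λ n →
    solve 2 (λ a b →
      (a :- a) :* (a :- a) :+ (b :- b) :* (b :- b) := con 0ℚ)
      refl (seq a n) (seq b n)
    where open +-*-Solver

  Distance-resp : ∀ {p p′ q q′ d} → p ≈² p′ → q ≈² q′ →
                  Distance p q d → Distance p′ q′ d
  Distance-resp {p} {p′} {q} {q′} {d} p≈ q≈ (0≤d , eq) =
    0≤d , ≃-trans {d * d} {Δ² p q} {Δ² p′ q′} eq (Δ²-cong {p} {p′} {q} {q′} p≈ q≈)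

  Distance-sym : ∀ {p q d} → Distance p q d → Distance q p d
  Distance-sym {p} {q} {d} (0≤d , eq) =
    0≤d , ≃-trans {d * d} {Δ² p q} {Δ² q p} eq (Δ²-sym p q)

  1≄0 : ¬ (1ℝ * 1ℝ ≃ 0ℝ)
  1≄0 1≃0 = let N , 1<½ = 1≃0 ½ (ℚ.positive⁻¹ ½)
            in ℚ.<-asym {½} {1ℚ} (ℚ.*<* (ℤ.+<+ (ℕ.s≤s (ℕ.s≤s ℕ.z≤n)))) (1<½ N ℕ.≤-refl)

  Distance-irrefl : ∀ {p q} → p ≈² q → ¬ Distance p q 1ℝ
  Distance-irrefl {p} {q} p≈q (_ , eq) =
    1≄0 (≃-trans {1ℝ * 1ℝ} {Δ² p q} {0ℝ} eq
      (≃-trans {Δ² p q} {Δ² p p} {0ℝ}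
        (Δ²-cong {p} {p} {q} {p} (Setoid.refl ℝ²-setoid {p})
          (Setoid.sym ℝ²-setoid {p} {q} p≈q))
        (Δ²-self p)))

------------------------------------------------------------------------
-- Simple graphs

record Graph c ℓ e : Set (lsuc (c ⊔ ℓ ⊔ e)) where
  field
    vertices : Setoid c ℓ

  open Setoid vertices public using (_≈_) renaming (Carrier to Vertex)

  field
    Adjacent : Rel Vertex e
    resp     : Adjacent Respects₂ _≈_
    symm     : Symmetric Adjacent
    irrefl   : Irreflexive _≈_ Adjacent

record _≅_ {c ℓ e c′ ℓ′ e′} (G : Graph c ℓ e) (H : Graph c′ ℓ′ e′)
       : Set (c ⊔ ℓ ⊔ e ⊔ c′ ⊔ ℓ′ ⊔ e′) where
  private
    module G = Graph G
    module H = Graph H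
  field
    bijection : Inverse G.vertices H.vertices

  open Inverse bijection public

  field
    adjacent : ∀ u v → G.Adjacent u v ⇔ H.Adjacent (to u) (to v)

infix 4 _≅_

------------------------------------------------------------------------
-- Unit distance graphs of strips

unitDistanceGraph : Pred ℝ² 0ℓ → Graph 0ℓ 0ℓ 0ℓ
unitDistanceGraph V = record
  { vertices = On.setoid {B = Σ ℝ² V} ℝ²-setoid proj₁
  ; Adjacent = λ (p , _) (q , _) → Distance p q 1ℝ
  ; resp     =
      (λ {(p , _)} {(q , _)} {(q′ , _)} q≈ →
        Distance-resp {p} {p} {q} {q′} {1ℝ} (Setoid.refl ℝ²-setoid {p}) q≈)
    , (λ {(q , _)} {(p , _)} {(p′ , _)} p≈ →
        Distance-resp {p} {p′} {q} {q} {1ℝ} p≈ (Setoid.refl ℝ²-setoid {q}))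
  ; symm     = λ {(p , _)} {(q , _)} → Distance-sym {p} {q} {1ℝ}
  ; irrefl   = λ {(p , _)} {(q , _)} → Distance-irrefl {p} {q}
  }

-- ℝ × [0, ε]
strip : ℝ → Pred ℝ² 0ℓ
strip ε (x , y) = 0ℝ ≤ y × y ≤ ε

{-# OPTIONS --safe #-}
module Submission where

-- There is no injective unit-distance-preserving map f from the strip of width ε₁
-- to that of width ε₂ < ε₁.  A unit 4-cycle is a rhombus, so the displacement
-- f (p + v) − f p does not change when p moves by a unit vector w ≠ ± v.  Take
-- unit vectors u = (c , h) and ū = (c , − h) with c, h rational, h small, and
-- ε₂ < k h ≤ ε₁.  Moving only along directions not parallel to u one can still
-- translate by u and by (2c , 0), so f has constant displacements φ along u and
-- ψ along ū, on the climb p + j u as well as on the zigzag with steps u, ū.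
-- The zigzag stays in the strip, so φ + ψ is horizontal; some number A of its
-- periods is also covered by 2cA horizontal unit steps, so |φ + ψ| ≤ 2c.  As φ and
-- ψ are unit vectors and not opposite, φ rises or falls by at least h, and the
-- image of the climb p, p + u, …, p + k u would need height k h > ε₂.

open import Algebra.Bundles using (CommutativeRing)
import Algebra.Solver.Ring as RingSolver
open import Algebra.Solver.Ring.AlmostCommutativeRing
  using (_-Raw-AlmostCommutative⟶_; fromCommutativeRing)
open import Axiom.ExcludedMiddle using (ExcludedMiddle)
open import Data.Empty using (⊥; ⊥-elim)
import Data.Integer.Base as ℤ
import Data.Integer.Properties as ℤ
import Data.Maybe.Base as Maybe
open import Data.Nat.Base as ℕ using (ℕ; zero; suc)
import Data.Nat.Properties as ℕ
open import Data.Product using (Σ; ∃-syntax; _×_; _,_; proj₁; proj₂)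
open import Data.Rational.Base as ℚ using (ℚ; 0ℚ; 1ℚ; ½; ∣_∣)
import Data.Rational.Properties as ℚ
open import Data.Rational.Solver using () renaming (module +-*-Solver to ℚSolver)
import Data.Rational.Unnormalised.Base as ℚᵘ
import Data.Rational.Unnormalised.Properties as ℚᵘ
open import Data.Sum.Base as Sum using (_⊎_; inj₁; inj₂; [_,_]′)
open import Function.Base using (_∘_; id; case_of_)
open import Function.Bundles using (_⇔_; mk⇔; Equivalence; Injection)
import Function.Properties.Inverse as Inverse
open import Level using (0ℓ)
open import Relation.Binary.Bundles using (Setoid)
open import Relation.Binary.Core using (Rel)
open import Relation.Binary.PropositionalEquality using (_≡_; refl; cong; subst)
import Relation.Binary.PropositionalEquality as ≡
open import Relation.Binary.Structures using (IsTotalOrder)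
open import Relation.Nullary.Decidable.Core using (Dec; yes; no; dec⇒maybe; decidable-stable)
open import Relation.Nullary.Negation.Core using (¬_)

-- Rational arithmetic and rational points of the unit circle.

2ℚ 3ℚ 4ℚ : ℚ
2ℚ = 1ℚ ℚ.+ 1ℚ
3ℚ = 1ℚ ℚ.+ 2ℚ
4ℚ = 1ℚ ℚ.+ 3ℚ

-- Recursion instead of a fraction: multiples by `n + 1` then unfold through additivity of `ι`
-- alone, as in `times-suc`.
fromℕ : ℕ → ℚ
fromℕ zero    = 0ℚ
fromℕ (suc n) = 1ℚ ℚ.+ fromℕ n

module _ where

  open ℚSolver using (solve; con; _:+_; _:-_; _:*_; _:=_)

  pos-* : ∀ {p q} → 0ℚ ℚ.< p → 0ℚ ℚ.< q → 0ℚ ℚ.< p ℚ.* q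
  pos-* {p} {q} 0<p 0<q = ℚ.positive⁻¹ (p ℚ.* q)
    {{ℚ.pos*pos⇒pos p {{ℚ.positive 0<p}} q {{ℚ.positive 0<q}}}}

  nonNeg-* : ∀ {p q} → 0ℚ ℚ.≤ p → 0ℚ ℚ.≤ q → 0ℚ ℚ.≤ p ℚ.* q
  nonNeg-* {p} {q} 0≤p 0≤q = ℚ.nonNegative⁻¹ (p ℚ.* q)
    {{ℚ.nonNeg*nonNeg⇒nonNeg p {{ℚ.nonNegative 0≤p}} q {{ℚ.nonNegative 0≤q}}}}

  ≤-from-diff : ∀ {p q r} → 0ℚ ℚ.≤ r → q ≡ p ℚ.+ r → p ℚ.≤ q
  ≤-from-diff {p} {q} {r} 0≤r refl = subst (ℚ._≤ q) (ℚ.+-identityʳ p) (ℚ.+-monoʳ-≤ p 0≤r)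

  toℚᵘ-fromℕ : ∀ n → ℚ.toℚᵘ (fromℕ n) ℚᵘ.≃ ℚᵘ.mkℚᵘ (ℤ.+ n) 0
  toℚᵘ-fromℕ zero    = ℚᵘ.≃-refl
  toℚᵘ-fromℕ (suc n) = ℚᵘ.≃-trans (ℚ.toℚᵘ-homo-+ 1ℚ (fromℕ n))
    (ℚᵘ.≃-trans (ℚᵘ.+-congʳ ℚᵘ.1ℚᵘ (toℚᵘ-fromℕ n))
      (ℚᵘ.*≡* (cong (λ m → (ℤ.+ 1 ℤ.+ m) ℤ.* ℤ.+ 1) (ℤ.*-identityʳ (ℤ.+ n)))))

  -- A rational stores its denominator minus one as `d`, so `A = d` makes `suc A` the denominator
  -- and `B` the numerator. The successor form keeps the multiplier nonzero, so that it can be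
  -- cancelled in `slower`.
  clear-denominator : ∀ q → 0ℚ ℚ.≤ q → ∃[ A ] ∃[ B ] fromℕ (suc A) ℚ.* q ≡ fromℕ B
  clear-denominator q@(ℚ.mkℚ (ℤ.+ n) d _) _ = d , n , ℚ.toℚᵘ-injective
    (ℚᵘ.≃-trans (ℚ.toℚᵘ-homo-* (fromℕ (suc d)) q)
    (ℚᵘ.≃-trans (ℚᵘ.*-congʳ {ℚ.toℚᵘ q} (toℚᵘ-fromℕ (suc d)))
    (ℚᵘ.≃-trans (ℚᵘ.*≡* cross) (ℚᵘ.≃-sym (toℚᵘ-fromℕ n)))))
    where
    cross : (ℤ.+ suc d ℤ.* ℤ.+ n) ℤ.* ℤ.+ 1 ≡ ℤ.+ n ℤ.* ℤ.+ (1 ℕ.* suc d)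
    cross = ≡.trans (ℤ.*-identityʳ _) (≡.trans (ℤ.*-comm (ℤ.+ suc d) (ℤ.+ n))
      (cong (λ m → ℤ.+ n ℤ.* ℤ.+ m) (≡.sym (ℕ.*-identityˡ (suc d)))))
  clear-denominator (ℚ.mkℚ ℤ.-[1+ _ ] _ _) 0≤q = case ℚ.nonNegative 0≤q of λ ()

  -- `(c , h)` is the step of climb and zigzag, `(c₁ , a)` a flatter auxiliary unit vector. The last
  -- field gives `2c = 8c₁ − 6`, so `(2c , 0)` is a sum of unit vectors not parallel to `(c , ± h)`.
  -- The bound on `2h` leaves room for two levels in the wider strip and makes `h` at most the gap
  -- between the widths.
  record RationalSlopes (δ : ℚ) : Set where
    field
      c h c₁ a   : ℚ
      0<c        : 0ℚ ℚ.< c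
      0<h        : 0ℚ ℚ.< h
      2h≤δ       : h ℚ.+ h ℚ.≤ δ
      0≤a        : 0ℚ ℚ.≤ a
      a≤h        : a ℚ.≤ h
      c²+h²≡1    : c ℚ.* c ℚ.+ h ℚ.* h ≡ 1ℚ
      c₁²+a²≡1   : c₁ ℚ.* c₁ ℚ.+ a ℚ.* a ≡ 1ℚ
      c+3≡4c₁    : c ℚ.+ 3ℚ ≡ 4ℚ ℚ.* c₁

  -- With tan (θ/2) = t and tan (θ₁/2) = t₁, the relation 1 − cos θ = 4 (1 − cos θ₁)
  -- says that (t , t/t₁) lies on the conic s² = 4 + 3t², parametrised by
  -- t = 4x/(3 − x²), t₁ = 2x/(3 + x²).
  rationalSlopes : ∀ {δ} → 0ℚ ℚ.< δ → RationalSlopes δ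
  rationalSlopes {δ} 0<δ = record
    { c = C ℚ.* d ; h = H ℚ.* d ; c₁ = C₁ ℚ.* d ; a = A ℚ.* d
    ; 0<c = pos-* (subst (0ℚ ℚ.<_)
        (≡.sym (solve 1 (λ x → con 9ℚ :- con 22ℚ :* (x :* x) :+ x :* x :* (x :* x) :=
          con 7/2 :+ (con 22ℚ :* ((con ½ :- x) :* (con ½ :+ x)) :+ x :* x :* (x :* x))) refl x))
        (ℚ.+-mono-<-≤ (ℚ.positive⁻¹ 7/2)
          (ℚ.+-mono-≤ (nonNeg-* (ℚ.nonNegative⁻¹ 22ℚ) 0≤¼-x²) (nonNeg-* 0≤x² 0≤x²)))) 0<d
    ; 0<h = pos-* (pos-* (pos-* (ℚ.positive⁻¹ 8ℚ) 0<x) (subst (0ℚ ℚ.<_)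
        (≡.sym (solve 1 (λ x → con 3ℚ :- x :* x :=
          con 11/4 :+ (con ½ :- x) :* (con ½ :+ x)) refl x))
        (ℚ.+-mono-<-≤ (ℚ.positive⁻¹ 11/4) 0≤¼-x²))) 0<d
    ; 2h≤δ = ℚ.≤-trans
        (≤-from-diff
          (nonNeg-* (nonNeg-* (ℚ.<⇒≤ 0<x) (ℚ.<⇒≤ 0<d))
            (ℚ.+-mono-≤ (ℚ.nonNegative⁻¹ 6ℚ)
              (ℚ.+-mono-≤ (nonNeg-* (ℚ.nonNegative⁻¹ 76ℚ) 0≤x²)
                          (nonNeg-* (ℚ.nonNegative⁻¹ 6ℚ) (nonNeg-* 0≤x² 0≤x²)))))
          (≡.trans (normalise (6ℚ ℚ.* x)) (solve 2 (λ x d →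
            con 6ℚ :* x :* ((con 9ℚ :+ con 10ℚ :* (x :* x) :+ x :* x :* (x :* x)) :* d) :=
            (con 8ℚ :* x :* (con 3ℚ :- x :* x) :* d :+ con 8ℚ :* x :* (con 3ℚ :- x :* x) :* d) :+
            x :* d :* (con 6ℚ :+ (con 76ℚ :* (x :* x) :+ con 6ℚ :* (x :* x :* (x :* x)))))
            refl x d)))
        6x≤δ
    ; 0≤a = nonNeg-* (nonNeg-* (nonNeg-* (ℚ.nonNegative⁻¹ 4ℚ) (ℚ.<⇒≤ 0<x))
        (ℚ.+-mono-≤ (ℚ.nonNegative⁻¹ 3ℚ) 0≤x²)) (ℚ.<⇒≤ 0<d)
    ; a≤h = ≤-from-diff
        (nonNeg-* (nonNeg-* (nonNeg-* (ℚ.nonNegative⁻¹ 12ℚ) (ℚ.<⇒≤ 0<x)) (ℚ.<⇒≤ 0<d))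
          (ℚ.+-mono-≤ (ℚ.nonNegative⁻¹ ¾) 0≤¼-x²))
        (solve 2 (λ x d → con 8ℚ :* x :* (con 3ℚ :- x :* x) :* d :=
          con 4ℚ :* x :* (con 3ℚ :+ x :* x) :* d :+
          con 12ℚ :* x :* d :* (con ¾ :+ (con ½ :- x) :* (con ½ :+ x))) refl x d)
    ; c²+h²≡1 = unitCircle {C} {H} (solve 1 (λ x →
        (con 9ℚ :- con 22ℚ :* (x :* x) :+ x :* x :* (x :* x)) :*
        (con 9ℚ :- con 22ℚ :* (x :* x) :+ x :* x :* (x :* x)) :+
        con 8ℚ :* x :* (con 3ℚ :- x :* x) :* (con 8ℚ :* x :* (con 3ℚ :- x :* x)) :=
        (con 9ℚ :+ con 10ℚ :* (x :* x) :+ x :* x :* (x :* x)) :*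
        (con 9ℚ :+ con 10ℚ :* (x :* x) :+ x :* x :* (x :* x))) refl x)
    ; c₁²+a²≡1 = unitCircle {C₁} {A} (solve 1 (λ x →
        (con 9ℚ :+ con 2ℚ :* (x :* x) :+ x :* x :* (x :* x)) :*
        (con 9ℚ :+ con 2ℚ :* (x :* x) :+ x :* x :* (x :* x)) :+
        con 4ℚ :* x :* (con 3ℚ :+ x :* x) :* (con 4ℚ :* x :* (con 3ℚ :+ x :* x)) :=
        (con 9ℚ :+ con 10ℚ :* (x :* x) :+ x :* x :* (x :* x)) :*
        (con 9ℚ :+ con 10ℚ :* (x :* x) :+ x :* x :* (x :* x))) refl x)
    ; c+3≡4c₁ = ≡.trans (cong (C ℚ.* d ℚ.+_) (normalise 3ℚ)) (solve 2 (λ x d →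
        (con 9ℚ :- con 22ℚ :* (x :* x) :+ x :* x :* (x :* x)) :* d :+
        con 3ℚ :* ((con 9ℚ :+ con 10ℚ :* (x :* x) :+ x :* x :* (x :* x)) :* d) :=
        con 4ℚ :* ((con 9ℚ :+ con 2ℚ :* (x :* x) :+ x :* x :* (x :* x)) :* d)) refl x d)
    }
    where
    6ℚ 8ℚ 9ℚ 10ℚ 12ℚ 22ℚ 76ℚ 7/2 11/4 ¾ ⅙ : ℚ
    6ℚ   = ℤ.+ 6 ℚ./ 1
    8ℚ   = ℤ.+ 8 ℚ./ 1
    9ℚ   = ℤ.+ 9 ℚ./ 1
    10ℚ  = ℤ.+ 10 ℚ./ 1
    12ℚ  = ℤ.+ 12 ℚ./ 1
    22ℚ  = ℤ.+ 22 ℚ./ 1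
    76ℚ  = ℤ.+ 76 ℚ./ 1
    7/2  = ℤ.+ 7 ℚ./ 2
    11/4 = ℤ.+ 11 ℚ./ 4
    ¾    = ℤ.+ 3 ℚ./ 4
    ⅙    = ℤ.+ 1 ℚ./ 6

    -- The bound `½` makes `C` positive and gives `a ≤ h`. The bound `δ/6` gives `2h ≤ 6x ≤ δ`: for
    -- small `x`, `2h` is close to `16x/3`.
    x = ½ ℚ.⊓ (⅙ ℚ.* δ)
    -- `(3 − x²)² + (4x)²` and `(3 + x²)² + (2x)²` both equal `N`, so the half-angle formulas give
    -- both points with the same denominator.
    N  = 9ℚ ℚ.+ 10ℚ ℚ.* (x ℚ.* x) ℚ.+ x ℚ.* x ℚ.* (x ℚ.* x)
    C  = 9ℚ ℚ.- 22ℚ ℚ.* (x ℚ.* x) ℚ.+ x ℚ.* x ℚ.* (x ℚ.* x)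
    H  = 8ℚ ℚ.* x ℚ.* (3ℚ ℚ.- x ℚ.* x)
    C₁ = 9ℚ ℚ.+ 2ℚ ℚ.* (x ℚ.* x) ℚ.+ x ℚ.* x ℚ.* (x ℚ.* x)
    A  = 4ℚ ℚ.* x ℚ.* (3ℚ ℚ.+ x ℚ.* x)

    0<x : 0ℚ ℚ.< x
    0<x = [ (λ eq → subst (0ℚ ℚ.<_) (≡.sym eq) (ℚ.positive⁻¹ ½))
          , (λ eq → subst (0ℚ ℚ.<_) (≡.sym eq) (pos-* (ℚ.positive⁻¹ ⅙) 0<δ)) ]′
          (ℚ.⊓-sel ½ (⅙ ℚ.* δ))

    0≤x² : 0ℚ ℚ.≤ x ℚ.* x
    0≤x² = nonNeg-* (ℚ.<⇒≤ 0<x) (ℚ.<⇒≤ 0<x)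

    0≤¼-x² : 0ℚ ℚ.≤ (½ ℚ.- x) ℚ.* (½ ℚ.+ x)
    0≤¼-x² = nonNeg-*
      (subst (ℚ._≤ ½ ℚ.- x) (ℚ.+-inverseʳ x) (ℚ.+-monoˡ-≤ (ℚ.- x) (ℚ.p⊓q≤p ½ (⅙ ℚ.* δ))))
      (ℚ.+-mono-≤ (ℚ.nonNegative⁻¹ ½) (ℚ.<⇒≤ 0<x))

    6x≤δ : 6ℚ ℚ.* x ℚ.≤ δ
    6x≤δ = subst (6ℚ ℚ.* x ℚ.≤_)
      (solve 1 (λ δ → con 6ℚ :* (con ⅙ :* δ) := δ) refl δ)
      (ℚ.*-monoˡ-≤-nonNeg 6ℚ (ℚ.p⊓q≤q ½ (⅙ ℚ.* δ)))

    0<N : 0ℚ ℚ.< N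
    0<N = ℚ.+-mono-<-≤ (ℚ.+-mono-<-≤ (ℚ.positive⁻¹ 9ℚ) (nonNeg-* (ℚ.nonNegative⁻¹ 10ℚ) 0≤x²))
      (nonNeg-* 0≤x² 0≤x²)

    instance
      N-pos : ℚ.Positive N
      N-pos = ℚ.positive 0<N
      N-nonZero : ℚ.NonZero N
      N-nonZero = ℚ.pos⇒nonZero N

    d = ℚ.1/ N

    0<d : 0ℚ ℚ.< d
    0<d = ℚ.positive⁻¹ d {{ℚ.1/pos⇒pos N}}

    normalise : ∀ p → p ≡ p ℚ.* (N ℚ.* d)
    normalise p = ≡.trans (≡.sym (ℚ.*-identityʳ p)) (cong (p ℚ.*_) (≡.sym (ℚ.*-inverseʳ N)))

    unitCircle : ∀ {X Y} → X ℚ.* X ℚ.+ Y ℚ.* Y ≡ N ℚ.* N →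
                 X ℚ.* d ℚ.* (X ℚ.* d) ℚ.+ Y ℚ.* d ℚ.* (Y ℚ.* d) ≡ 1ℚ
    unitCircle {X} {Y} eq = ≡.trans
      (solve 3 (λ X Y d → X :* d :* (X :* d) :+ Y :* d :* (Y :* d) :=
        (X :* X :+ Y :* Y) :* (d :* d)) refl X Y d)
      (≡.trans (cong (ℚ._* (d ℚ.* d)) eq) (≡.trans
        (solve 2 (λ N d → N :* N :* (d :* d) := N :* d :* (N :* d)) refl N d)
        (≡.cong₂ ℚ._*_ (ℚ.*-inverseʳ N) (ℚ.*-inverseʳ N))))

-- The properties of the reals on which the geometry rests. Rational coefficients come from the
-- morphism, which also feeds the ring solver; cancellation goes through `integral` instead of
-- inverses.
record ArchimedeanDomain : Set₁ where
  infix 4 _≤_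
  field
    commutativeRing : CommutativeRing 0ℓ 0ℓ

  open CommutativeRing commutativeRing public
    using (Carrier; _≈_; _+_; _*_; -_; _-_; +-cong; *-cong; -‿cong)
    renaming (refl to ≈-refl; sym to ≈-sym; trans to ≈-trans)

  field
    morphism     : ℚ.+-*-rawRing -Raw-AlmostCommutative⟶ fromCommutativeRing commutativeRing

  open _-Raw-AlmostCommutative⟶_ morphism public using () renaming
    (⟦_⟧ to ι; +-homo to ι-+; *-homo to ι-*)

  field
    _≤_          : Rel Carrier 0ℓ
    isTotalOrder : IsTotalOrder _≈_ _≤_
    +-monoʳ-≤    : ∀ z {x y} → x ≤ y → z + x ≤ z + y
    *-nonNeg     : ∀ {x y} → ι 0ℚ ≤ x → ι 0ℚ ≤ y → ι 0ℚ ≤ x * y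
    integral     : ∀ {x y} → x * y ≈ ι 0ℚ → x ≈ ι 0ℚ ⊎ y ≈ ι 0ℚ
    ι-mono       : ∀ {p q} → p ℚ.≤ q → ι p ≤ ι q
    ι-cancel     : ∀ {p q} → ι p ≤ ι q → p ℚ.≤ q
    archimedean  : ∀ {x b} → (∀ n → ι (fromℕ n) * x ≤ b) → x ≤ ι 0ℚ

  open IsTotalOrder isTotalOrder public using (total) renaming
    (reflexive to ≤-reflexive; trans to ≤-trans; antisym to ≤-antisym)

-- Geometry over an Archimedean ordered domain containing ℚ

module Ordered (F : ArchimedeanDomain) where

  open ArchimedeanDomain F public
  open CommutativeRing commutativeRing using () renaming (reflexive to ≈-reflexive)

  open RingSolver ℚ.+-*-rawRing (fromCommutativeRing commutativeRing) morphism
    (λ p q → Maybe.map (λ p≡q → ≈-reflexive (cong ι p≡q)) (dec⇒maybe (p ℚ.≟ q)))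
    public using (solve; con; _:+_; _:-_; _:*_; :-_; _:=_)

  ≈⇒diff≈0 : ∀ {x y} → x ≈ y → x - y ≈ ι 0ℚ
  ≈⇒diff≈0 {x} {y} x≈y = ≈-trans (+-cong x≈y ≈-refl)
    (solve 1 (λ y → y :- y := con 0ℚ) ≈-refl y)

  diff≈0⇒≈ : ∀ {x y} → x - y ≈ ι 0ℚ → x ≈ y
  diff≈0⇒≈ {x} {y} eq = ≈-trans
    (solve 2 (λ x y → x := (x :- y) :+ y) ≈-refl x y)
    (≈-trans (+-cong eq ≈-refl) (solve 1 (λ y → con 0ℚ :+ y := y) ≈-refl y))

  -- Proof by linear combination: once `a − b` is exhibited as a multiple of `l − r`, only a
  -- polynomial identity is left for the ring solver.
  combine : ∀ {a b l r} k → l ≈ r → a - b ≈ k * (l - r) → a ≈ b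
  combine k l≈r eq = diff≈0⇒≈ (≈-trans eq (≈-trans
    (*-cong ≈-refl (≈⇒diff≈0 l≈r))
    (solve 1 (λ k → k :* con 0ℚ := con 0ℚ) ≈-refl k)))

  combine₂ : ∀ {a b l r l′ r′} k k′ → l ≈ r → l′ ≈ r′ →
             a - b ≈ k * (l - r) + k′ * (l′ - r′) → a ≈ b
  combine₂ k k′ l≈r l′≈r′ eq = diff≈0⇒≈ (≈-trans eq (≈-trans
    (+-cong (*-cong ≈-refl (≈⇒diff≈0 l≈r)) (*-cong ≈-refl (≈⇒diff≈0 l′≈r′)))
    (solve 2 (λ k k′ → k :* con 0ℚ :+ k′ :* con 0ℚ := con 0ℚ) ≈-refl k k′)))

  ≤-refl : ∀ {x} → x ≤ x
  ≤-refl = ≤-reflexive ≈-refl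

  ≤-resp : ∀ {x x′ y y′} → x ≈ x′ → y ≈ y′ → x ≤ y → x′ ≤ y′
  ≤-resp x≈ y≈ x≤y = ≤-trans (≤-reflexive (≈-sym x≈)) (≤-trans x≤y (≤-reflexive y≈))

  ≤⇒0≤diff : ∀ {x y} → x ≤ y → ι 0ℚ ≤ y - x
  ≤⇒0≤diff {x} {y} x≤y = ≤-resp
    (solve 1 (λ x → :- x :+ x := con 0ℚ) ≈-refl x)
    (solve 2 (λ x y → :- x :+ y := y :- x) ≈-refl x y)
    (+-monoʳ-≤ (- x) x≤y)

  ≤-from : ∀ {x y z} → ι 0ℚ ≤ z → y - x ≈ z → x ≤ y
  ≤-from {x} {y} 0≤z eq = ≤-resp
    (solve 1 (λ x → x :+ con 0ℚ := x) ≈-refl x)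
    (solve 2 (λ x y → x :+ (y :- x) := y) ≈-refl x y)
    (+-monoʳ-≤ x (≤-trans 0≤z (≤-reflexive (≈-sym eq))))

  +-nonNeg : ∀ {x y} → ι 0ℚ ≤ x → ι 0ℚ ≤ y → ι 0ℚ ≤ x + y
  +-nonNeg {x} 0≤x 0≤y = ≤-trans 0≤x (≤-resp
    (solve 1 (λ x → x :+ con 0ℚ := x) ≈-refl x) ≈-refl (+-monoʳ-≤ x 0≤y))

  +-mono-≤ : ∀ {x x′ y y′} → x ≤ x′ → y ≤ y′ → x + y ≤ x′ + y′
  +-mono-≤ {x} {x′} {y} {y′} x≤ y≤ = ≤-from (+-nonNeg (≤⇒0≤diff x≤) (≤⇒0≤diff y≤))
    (solve 4 (λ x x′ y y′ → (x′ :+ y′) :- (x :+ y) := (x′ :- x) :+ (y′ :- y))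
      ≈-refl x x′ y y′)

  neg-nonNeg : ∀ {x} → x ≤ ι 0ℚ → ι 0ℚ ≤ - x
  neg-nonNeg {x} x≤0 = ≤-resp ≈-refl
    (solve 1 (λ x → con 0ℚ :- x := :- x) ≈-refl x) (≤⇒0≤diff x≤0)

  square-nonNeg : ∀ x → ι 0ℚ ≤ x * x
  square-nonNeg x = [ (λ 0≤x → *-nonNeg 0≤x 0≤x)
                    , (λ x≤0 → ≤-resp ≈-refl
                        (solve 1 (λ x → :- x :* :- x := x :* x) ≈-refl x)
                        (*-nonNeg (neg-nonNeg x≤0) (neg-nonNeg x≤0))) ]′
                    (total (ι 0ℚ) x)

  square≈0 : ∀ {x} → x * x ≈ ι 0ℚ → x ≈ ι 0ℚ
  square≈0 = [ id , id ]′ ∘ integral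

  sumOfSquares≈0 : ∀ {x y} → x * x + y * y ≈ ι 0ℚ → x ≈ ι 0ℚ × y ≈ ι 0ℚ
  sumOfSquares≈0 {x} {y} eq =
    square≈0 (left x y eq) ,
    square≈0 (left y x (≈-trans (solve 2 (λ x y → y :* y :+ x :* x := x :* x :+ y :* y) ≈-refl x y) eq))
    where
    left : ∀ x y → x * x + y * y ≈ ι 0ℚ → x * x ≈ ι 0ℚ
    left x y eq = ≤-antisym
      (≤-from (square-nonNeg y)
        (combine (ι (ℚ.- 1ℚ)) eq
          (solve 2 (λ x y → con 0ℚ :- x :* x :- y :* y :=
            con (ℚ.- 1ℚ) :* (x :* x :+ y :* y :- con 0ℚ)) ≈-refl x y)))
      (square-nonNeg x)

  -- `|w|²` times the cross product of `x` and `y` is a linear combination of `w · x` and `w · y`,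
  -- and `|w|²` does not vanish.
  orthogonal⇒parallel : ∀ {w₁ w₂ x₁ x₂ y₁ y₂} → ¬ (w₁ ≈ ι 0ℚ × w₂ ≈ ι 0ℚ) →
    w₁ * x₁ + w₂ * x₂ ≈ ι 0ℚ → w₁ * y₁ + w₂ * y₂ ≈ ι 0ℚ →
    x₁ * y₂ - x₂ * y₁ ≈ ι 0ℚ
  orthogonal⇒parallel {w₁} {w₂} {x₁} {x₂} {y₁} {y₂} w≉0 w⊥x w⊥y =
    [ ⊥-elim ∘ w≉0 ∘ sumOfSquares≈0 , id ]′ (integral
      (combine₂ (w₁ * y₂ - w₂ * y₁) (w₂ * x₁ - w₁ * x₂) w⊥x w⊥y
        (solve 6 (λ w₁ w₂ x₁ x₂ y₁ y₂ →
          (w₁ :* w₁ :+ w₂ :* w₂) :* (x₁ :* y₂ :- x₂ :* y₁) :- con 0ℚ :=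
          (w₁ :* y₂ :- w₂ :* y₁) :* (w₁ :* x₁ :+ w₂ :* x₂ :- con 0ℚ) :+
          (w₂ :* x₁ :- w₁ :* x₂) :* (w₁ :* y₁ :+ w₂ :* y₂ :- con 0ℚ))
          ≈-refl w₁ w₂ x₁ x₂ y₁ y₂)))

  -- A unit 4-cycle 0, b, d, c: both d and b + c are orthogonal to b − c, and
  -- d is orthogonal to d − (b + c).
  rhombus : ∀ {b₁ b₂ c₁ c₂ d₁ d₂} →
    b₁ * b₁ + b₂ * b₂ ≈ ι 1ℚ → c₁ * c₁ + c₂ * c₂ ≈ ι 1ℚ →
    (d₁ - b₁) * (d₁ - b₁) + (d₂ - b₂) * (d₂ - b₂) ≈ ι 1ℚ →
    (d₁ - c₁) * (d₁ - c₁) + (d₂ - c₂) * (d₂ - c₂) ≈ ι 1ℚ →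
    ¬ (d₁ ≈ ι 0ℚ × d₂ ≈ ι 0ℚ) → ¬ (b₁ ≈ c₁ × b₂ ≈ c₂) →
    d₁ ≈ b₁ + c₁ × d₂ ≈ b₂ + c₂
  rhombus {b₁} {b₂} {c₁} {c₂} {d₁} {d₂} |b| |c| |d-b| |d-c| d≉0 b≉c =
    diff≈0⇒≈ (proj₁ g≈0) , diff≈0⇒≈ (proj₂ g≈0)
    where
    g₁ = d₁ - (b₁ + c₁)
    g₂ = d₂ - (b₂ + c₂)

    2d·b : d₁ * d₁ + d₂ * d₂ ≈ ι 2ℚ * (d₁ * b₁ + d₂ * b₂)
    2d·b = combine₂ (ι 1ℚ) (ι (ℚ.- 1ℚ)) |d-b| |b|
      (solve 4 (λ b₁ b₂ d₁ d₂ →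
        d₁ :* d₁ :+ d₂ :* d₂ :- con 2ℚ :* (d₁ :* b₁ :+ d₂ :* b₂) :=
        con 1ℚ :* ((d₁ :- b₁) :* (d₁ :- b₁) :+ (d₂ :- b₂) :* (d₂ :- b₂) :- con 1ℚ)
        :+ con (ℚ.- 1ℚ) :* (b₁ :* b₁ :+ b₂ :* b₂ :- con 1ℚ)) ≈-refl b₁ b₂ d₁ d₂)

    2d·c : d₁ * d₁ + d₂ * d₂ ≈ ι 2ℚ * (d₁ * c₁ + d₂ * c₂)
    2d·c = combine₂ (ι 1ℚ) (ι (ℚ.- 1ℚ)) |d-c| |c|
      (solve 4 (λ b₁ b₂ d₁ d₂ →
        d₁ :* d₁ :+ d₂ :* d₂ :- con 2ℚ :* (d₁ :* b₁ :+ d₂ :* b₂) :=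
        con 1ℚ :* ((d₁ :- b₁) :* (d₁ :- b₁) :+ (d₂ :- b₂) :* (d₂ :- b₂) :- con 1ℚ)
        :+ con (ℚ.- 1ℚ) :* (b₁ :* b₁ :+ b₂ :* b₂ :- con 1ℚ)) ≈-refl c₁ c₂ d₁ d₂)

    b-c⊥d : (b₁ - c₁) * d₁ + (b₂ - c₂) * d₂ ≈ ι 0ℚ
    b-c⊥d = combine₂ (ι (ℚ.- ½)) (ι ½) 2d·b 2d·c
      (solve 6 (λ b₁ b₂ c₁ c₂ d₁ d₂ →
        (b₁ :- c₁) :* d₁ :+ (b₂ :- c₂) :* d₂ :- con 0ℚ :=
        con (ℚ.- ½) :* (d₁ :* d₁ :+ d₂ :* d₂ :- con 2ℚ :* (d₁ :* b₁ :+ d₂ :* b₂))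
        :+ con ½ :* (d₁ :* d₁ :+ d₂ :* d₂ :- con 2ℚ :* (d₁ :* c₁ :+ d₂ :* c₂)))
        ≈-refl b₁ b₂ c₁ c₂ d₁ d₂)

    b-c⊥b+c : (b₁ - c₁) * (b₁ + c₁) + (b₂ - c₂) * (b₂ + c₂) ≈ ι 0ℚ
    b-c⊥b+c = combine₂ (ι 1ℚ) (ι (ℚ.- 1ℚ)) |b| |c|
      (solve 4 (λ b₁ b₂ c₁ c₂ →
        (b₁ :- c₁) :* (b₁ :+ c₁) :+ (b₂ :- c₂) :* (b₂ :+ c₂) :- con 0ℚ :=
        con 1ℚ :* (b₁ :* b₁ :+ b₂ :* b₂ :- con 1ℚ)
        :+ con (ℚ.- 1ℚ) :* (c₁ :* c₁ :+ c₂ :* c₂ :- con 1ℚ)) ≈-refl b₁ b₂ c₁ c₂)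

    d∥b+c : d₁ * (b₂ + c₂) - d₂ * (b₁ + c₁) ≈ ι 0ℚ
    d∥b+c = orthogonal⇒parallel
      (λ (eq₁ , eq₂) → b≉c (diff≈0⇒≈ eq₁ , diff≈0⇒≈ eq₂)) b-c⊥d b-c⊥b+c

    d⊥g : d₁ * g₁ + d₂ * g₂ ≈ ι 0ℚ
    d⊥g = combine₂ (ι ½) (ι ½) 2d·b 2d·c
      (solve 6 (λ b₁ b₂ c₁ c₂ d₁ d₂ →
        d₁ :* (d₁ :- (b₁ :+ c₁)) :+ d₂ :* (d₂ :- (b₂ :+ c₂)) :- con 0ℚ :=
        con ½ :* (d₁ :* d₁ :+ d₂ :* d₂ :- con 2ℚ :* (d₁ :* b₁ :+ d₂ :* b₂))
        :+ con ½ :* (d₁ :* d₁ :+ d₂ :* d₂ :- con 2ℚ :* (d₁ :* c₁ :+ d₂ :* c₂)))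
        ≈-refl b₁ b₂ c₁ c₂ d₁ d₂)

    -- Lagrange's identity `|d|² |g|² = (d · g)² + (d × g)²`, where `d × g = − d × (b + c)` because
    -- `g = d − (b + c)`.
    |d|²|g|²≈0 : (d₁ * d₁ + d₂ * d₂) * (g₁ * g₁ + g₂ * g₂) ≈ ι 0ℚ
    |d|²|g|²≈0 = combine₂ (d₁ * g₁ + d₂ * g₂) (d₁ * (b₂ + c₂) - d₂ * (b₁ + c₁)) d⊥g d∥b+c
      (solve 4 (λ d₁ d₂ s₁ s₂ →
        (d₁ :* d₁ :+ d₂ :* d₂) :* ((d₁ :- s₁) :* (d₁ :- s₁) :+ (d₂ :- s₂) :* (d₂ :- s₂)) :- con 0ℚ :=
        (d₁ :* (d₁ :- s₁) :+ d₂ :* (d₂ :- s₂)) :* (d₁ :* (d₁ :- s₁) :+ d₂ :* (d₂ :- s₂) :- con 0ℚ)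
        :+ (d₁ :* s₂ :- d₂ :* s₁) :* (d₁ :* s₂ :- d₂ :* s₁ :- con 0ℚ))
        ≈-refl d₁ d₂ (b₁ + c₁) (b₂ + c₂))

    g≈0 : g₁ ≈ ι 0ℚ × g₂ ≈ ι 0ℚ
    g≈0 = [ ⊥-elim ∘ d≉0 ∘ sumOfSquares≈0 , sumOfSquares≈0 ]′ (integral |d|²|g|²≈0)

-- Unit vectors, strips and integer multiples.

module Strips (F : ArchimedeanDomain) where

  open Ordered F

  infix 4 _≈²_

  Point : Set
  Point = Carrier × Carrier

  _≈²_ : Rel Point 0ℓ
  (x , y) ≈² (x′ , y′) = x ≈ x′ × y ≈ y′

  ≈²-refl : ∀ {p} → p ≈² p
  ≈²-refl = ≈-refl , ≈-refl

  ≈²-sym : ∀ {p q} → p ≈² q → q ≈² p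
  ≈²-sym (x≈ , y≈) = ≈-sym x≈ , ≈-sym y≈

  ≈²-trans : ∀ {p q r} → p ≈² q → q ≈² r → p ≈² r
  ≈²-trans (x≈ , y≈) (x≈′ , y≈′) = ≈-trans x≈ x≈′ , ≈-trans y≈ y≈′

  Unit : Rel Point 0ℓ
  Unit (x , y) (x′ , y′) = (x - x′) * (x - x′) + (y - y′) * (y - y′) ≈ ι 1ℚ

  Direction : Carrier → Carrier → Set
  Direction c s = c * c + s * s ≈ ι 1ℚ

  Between : Carrier → Carrier → Set
  Between ε y = ι 0ℚ ≤ y × y ≤ ε

  direction⇒unit : ∀ {c s} x y → Direction c s → Unit (x , y) (x + c , y + s)
  direction⇒unit {c} {s} x y dir = ≈-trans
    (solve 4 (λ c s x y →
      (x :- (x :+ c)) :* (x :- (x :+ c)) :+ (y :- (y :+ s)) :* (y :- (y :+ s)) :=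
      c :* c :+ s :* s) ≈-refl c s x y)
    dir

  unit⇒direction : ∀ {x y x′ y′} → Unit (x , y) (x′ , y′) → Direction (x′ - x) (y′ - y)
  unit⇒direction {x} {y} {x′} {y′} unit = ≈-trans
    (solve 4 (λ x y x′ y′ →
      (x′ :- x) :* (x′ :- x) :+ (y′ :- y) :* (y′ :- y) :=
      (x :- x′) :* (x :- x′) :+ (y :- y′) :* (y :- y′)) ≈-refl x y x′ y′)
    unit

  direction-negʳ : ∀ {c s} → Direction c s → Direction c (- s)
  direction-negʳ {c} {s} dir = ≈-trans
    (solve 2 (λ c s → c :* c :+ :- s :* :- s := c :* c :+ s :* s) ≈-refl c s) dir

  direction-negˡ : ∀ {c s} → Direction c s → Direction (- c) s
  direction-negˡ {c} {s} dir = ≈-trans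
    (solve 2 (λ c s → :- c :* :- c :+ s :* s := c :* c :+ s :* s) ≈-refl c s) dir

  -- On the unit circle `1 − c` is half of `(1 − c)² + s²`.
  direction-≤1 : ∀ {c s} → Direction c s → c ≤ ι 1ℚ
  direction-≤1 {c} {s} dir = ≤-from
    (*-nonNeg (ι-mono 0≤½) (+-nonNeg (square-nonNeg (ι 1ℚ - c)) (square-nonNeg s)))
    (combine (ι (ℚ.- ½)) dir
      (solve 2 (λ c s →
        con 1ℚ :- c :- con ½ :* ((con 1ℚ :- c) :* (con 1ℚ :- c) :+ s :* s) :=
        con (ℚ.- ½) :* (c :* c :+ s :* s :- con 1ℚ)) ≈-refl c s))
    where
    0≤½ : 0ℚ ℚ.≤ ½
    0≤½ = ℚ.nonNegative⁻¹ ½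

  unit-resp : ∀ {p p′ q q′} → p ≈² p′ → q ≈² q′ → Unit p q → Unit p′ q′
  unit-resp (x≈ , y≈) (x′≈ , y′≈) = ≈-trans
    (+-cong (*-cong dx dx) (*-cong dy dy))
    where
    dx = +-cong (≈-sym x≈) (-‿cong (≈-sym x′≈))
    dy = +-cong (≈-sym y≈) (-‿cong (≈-sym y′≈))

  between-resp : ∀ {ε y y′} → y ≈ y′ → Between ε y → Between ε y′
  between-resp y≈y′ (0≤y , y≤ε) = ≤-resp ≈-refl y≈y′ 0≤y , ≤-resp y≈y′ ≈-refl y≤ε

  times-suc : ∀ n x → ι (fromℕ (suc n)) * x ≈ ι (fromℕ n) * x + x
  times-suc n x = combine x (ι-+ 1ℚ (fromℕ n))
    (solve 3 (λ m n x → m :* x :- (n :* x :+ x) := x :* (m :- (con 1ℚ :+ n)))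
      ≈-refl (ι (fromℕ (suc n))) (ι (fromℕ n)) x)

  times-nonNeg : ∀ n {x} → ι 0ℚ ≤ x → ι 0ℚ ≤ ι (fromℕ n) * x
  times-nonNeg zero    {x} 0≤x = ≤-reflexive (solve 1 (λ x → con 0ℚ := con 0ℚ :* x) ≈-refl x)
  times-nonNeg (suc n) {x} 0≤x = ≤-resp ≈-refl (≈-sym (times-suc n x)) (+-nonNeg (times-nonNeg n 0≤x) 0≤x)

  times-mono : ∀ {m n x} → ι 0ℚ ≤ x → m ℕ.≤ n → ι (fromℕ m) * x ≤ ι (fromℕ n) * x
  times-mono {n = n} {x} 0≤x ℕ.z≤n = ≤-resp (solve 1 (λ x → con 0ℚ := con 0ℚ :* x) ≈-refl x)
                               ≈-refl (times-nonNeg n 0≤x)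
  times-mono {suc m} {suc n} {x} 0≤x (ℕ.s≤s m≤n) =
    ≤-resp (≈-sym (times-suc m x)) (≈-sym (times-suc n x))
      (+-mono-≤ (times-mono 0≤x m≤n) ≤-refl)

  -- If `x ≤ 0`, then `x = (n + 1) x + n (− x)` is a sum of two nonnegative terms.
  times-cancel-nonNeg : ∀ n {x} → ι 0ℚ ≤ ι (fromℕ (suc n)) * x → ι 0ℚ ≤ x
  times-cancel-nonNeg n {x} 0≤nx = [ id , (λ x≤0 →
    ≤-from (+-nonNeg 0≤nx (times-nonNeg n (neg-nonNeg x≤0)))
      (combine (ι (ℚ.- 1ℚ)) (times-suc n x)
        (solve 3 (λ m n x → x :- con 0ℚ :- (m :* x :+ n :* (:- x)) :=
          con (ℚ.- 1ℚ) :* (m :* x :- (n :* x :+ x)))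
          ≈-refl (ι (fromℕ (suc n))) (ι (fromℕ n)) x))) ]′
    (total (ι 0ℚ) x)

  times-mono₂ : ∀ n {x y} → x ≤ y → ι (fromℕ n) * x ≤ ι (fromℕ n) * y
  times-mono₂ n {x} {y} x≤y = ≤-from (times-nonNeg n (≤⇒0≤diff x≤y))
    (solve 3 (λ n x y → n :* y :- n :* x := n :* (y :- x)) ≈-refl (ι (fromℕ n)) x y)

  -- If `y ≤ x`, then `(x − y) (x + y)` is nonnegative as a product and nonpositive by hypothesis,
  -- so one factor is zero. When it is `x + y`, the difference `y − x` equals `y + y`.
  square-cancel-≤ : ∀ {x y} → ι 0ℚ ≤ x → ι 0ℚ ≤ y → ι 0ℚ ≤ y * y - x * x → x ≤ y
  square-cancel-≤ {x} {y} 0≤x 0≤y x²≤y² = [ id , (λ y≤x →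
    [ ≤-reflexive ∘ diff≈0⇒≈ , (λ x+y≈0 →
        ≤-from (+-nonNeg 0≤y 0≤y) (combine (ι (ℚ.- 1ℚ)) x+y≈0
          (solve 2 (λ x y → y :- x :- (y :+ y) := con (ℚ.- 1ℚ) :* (x :+ y :- con 0ℚ))
            ≈-refl x y))) ]′
    (integral (≤-antisym
      (≤-from x²≤y² (solve 2 (λ x y →
        con 0ℚ :- (x :- y) :* (x :+ y) := y :* y :- x :* x) ≈-refl x y))
      (*-nonNeg (≤⇒0≤diff y≤x) (+-nonNeg 0≤x 0≤y))))) ]′
    (total x y)

  between-diff : ∀ {ε y y′} → Between ε y → Between ε y′ → y - y′ ≤ ε
  between-diff {ε} {y} {y′} (_ , y≤ε) (0≤y′ , _) = ≤-from (+-nonNeg (≤⇒0≤diff y≤ε) 0≤y′)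
    (solve 3 (λ ε y y′ → ε :- (y :- y′) := ε :- y :+ y′) ≈-refl ε y y′)

  -- Injective unit-distance-preserving maps between strips.

  module Homomorphism
    (ε₁ ε₂ : Carrier) (f : Point → Point)
    (f-cong   : ∀ {p q} → Between ε₁ (proj₂ p) → p ≈² q → f p ≈² f q)
    (f-strip  : ∀ {p} → Between ε₁ (proj₂ p) → Between ε₂ (proj₂ (f p)))
    (f-unit   : ∀ {p q} → Between ε₁ (proj₂ p) → Between ε₁ (proj₂ q) →
                Unit p q → Unit (f p) (f q))
    (f-inj    : ∀ {p q} → Between ε₁ (proj₂ p) → Between ε₁ (proj₂ q) →
                f p ≈² f q → p ≈² q)
    where

    In : Carrier → Set
    In = Between ε₁

    step : (c s x y : Carrier) → Point
    step c s x y = proj₁ (f (x + c , y + s)) - proj₁ (f (x , y))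
                 , proj₂ (f (x + c , y + s)) - proj₂ (f (x , y))

    step-cong : ∀ {c s x x′ y y′} → In y → In (y + s) → x ≈ x′ → y ≈ y′ →
                step c s x y ≈² step c s x′ y′
    step-cong iny inys x≈ y≈ =
      let p≈ = f-cong iny (x≈ , y≈)
          q≈ = f-cong inys (+-cong x≈ ≈-refl , +-cong y≈ ≈-refl)
      in +-cong (proj₁ q≈) (-‿cong (proj₁ p≈)) , +-cong (proj₂ q≈) (-‿cong (proj₂ p≈))

    step-direction : ∀ {c s x y} → Direction c s → In y → In (y + s) →
                     Direction (proj₁ (step c s x y)) (proj₂ (step c s x y))
    step-direction {x = x} {y} dir iny inys =
      unit⇒direction (f-unit iny inys (direction⇒unit x y dir))

    -- With `v = (c , s)` and `w = (r , t)`, the points `P`, `P + v`, `P + v + w`, `P + w` form a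
    -- unit 4-cycle, and so do their images. Injectivity keeps opposite vertices of the image
    -- distinct, one pair because `w ≠ v` and the other because `w ≠ − v`, so `rhombus` applies and
    -- opposite sides of the image have equal displacements.
    translate : ∀ {c s r t x y} → Direction c s → Direction r t →
      ¬ (r ≈ c × t ≈ s) → ¬ (r ≈ - c × t ≈ - s) →
      In y → In (y + s) → In (y + t) → In (y + t + s) →
      step c s x y ≈² step c s (x + r) (y + t)
    translate {c} {s} {r} {t} {x} {y} cs rt ≉ ≉- inP inQ inR inS =
      conclude (proj₁ d≈) , conclude (proj₂ d≈)
      where
      P = (x , y)
      Q = (x + c , y + s)
      R = (x + r , y + t)
      S = (x + r + c , y + t + s)

      QS : Unit Q S
      QS = ≈-trans
        (solve 6 (λ c s r t x y →
          (x :+ c :- (x :+ r :+ c)) :* (x :+ c :- (x :+ r :+ c)) :+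
          (y :+ s :- (y :+ t :+ s)) :* (y :+ s :- (y :+ t :+ s)) :=
          r :* r :+ t :* t) ≈-refl c s r t x y) rt

      relative : ∀ {q s p} → Unit q s →
        let (q₁ , q₂) = q ; (s₁ , s₂) = s ; (p₁ , p₂) = p in
        (s₁ - p₁ - (q₁ - p₁)) * (s₁ - p₁ - (q₁ - p₁)) +
        (s₂ - p₂ - (q₂ - p₂)) * (s₂ - p₂ - (q₂ - p₂)) ≈ ι 1ℚ
      relative {q₁ , q₂} {s₁ , s₂} {p₁ , p₂} unit = ≈-trans
        (solve 6 (λ q₁ q₂ s₁ s₂ p₁ p₂ →
          (s₁ :- p₁ :- (q₁ :- p₁)) :* (s₁ :- p₁ :- (q₁ :- p₁)) :+
          (s₂ :- p₂ :- (q₂ :- p₂)) :* (s₂ :- p₂ :- (q₂ :- p₂)) :=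
          (q₁ :- s₁) :* (q₁ :- s₁) :+ (q₂ :- s₂) :* (q₂ :- s₂))
          ≈-refl q₁ q₂ s₁ s₂ p₁ p₂) unit

      opposite : ∀ {x r c} → x + r + c ≈ x → r ≈ - c
      opposite {x} {r} {c} eq = combine (ι 1ℚ) eq
        (solve 3 (λ x r c → r :- :- c := con 1ℚ :* (x :+ r :+ c :- x)) ≈-refl x r c)

      cancel : ∀ {x r c} → x + c ≈ x + r → r ≈ c
      cancel {x} {r} {c} eq = combine (ι (ℚ.- 1ℚ)) eq
        (solve 3 (λ x r c → r :- c := con (ℚ.- 1ℚ) :* (x :+ c :- (x :+ r))) ≈-refl x r c)

      cancel-diff : ∀ {p q r} → q - p ≈ r - p → q ≈ r
      cancel-diff {p} {q} {r} eq = combine (ι 1ℚ) eq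
        (solve 3 (λ p q r → q :- r := con 1ℚ :* (q :- p :- (r :- p))) ≈-refl p q r)

      -- All image points are taken relative to `f P`, which becomes the vertex at the origin.
      d≈ = rhombus
        (unit⇒direction (f-unit inP inQ (direction⇒unit x y cs)))
        (unit⇒direction (f-unit inP inR (direction⇒unit x y rt)))
        (relative {p = f P} (f-unit inQ inS QS))
        (relative {p = f P} (f-unit inR inS (direction⇒unit (x + r) (y + t) cs)))
        (λ (eq₁ , eq₂) →
          let (x≈ , y≈) = f-inj inS inP (diff≈0⇒≈ eq₁ , diff≈0⇒≈ eq₂)
          in ≉- (opposite x≈ , opposite y≈))
        (λ (eq₁ , eq₂) →
          let (x≈ , y≈) = f-inj inQ inR (cancel-diff eq₁ , cancel-diff eq₂)
          in ≉ (cancel x≈ , cancel y≈))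

      conclude : ∀ {p q r s} → s - p ≈ (q - p) + (r - p) → q - p ≈ s - r
      conclude {p} {q} {r} {s} eq = combine (ι (ℚ.- 1ℚ)) eq
        (solve 4 (λ p q r s → q :- p :- (s :- r) :=
          con (ℚ.- 1ℚ) :* (s :- p :- (q :- p :+ (r :- p)))) ≈-refl p q r s)

    -- Every unit step along the bottom edge moves the first coordinate of the image by at most 1.
    -- The two inequalities stand for an absolute value.
    walk-≤ : In (ι 0ℚ) → ∀ n →
      proj₁ (f (ι (fromℕ n) , ι 0ℚ)) - proj₁ (f (ι 0ℚ , ι 0ℚ)) ≤ ι (fromℕ n) ×
      proj₁ (f (ι 0ℚ , ι 0ℚ)) - proj₁ (f (ι (fromℕ n) , ι 0ℚ)) ≤ ι (fromℕ n)
    walk-≤ in0 zero = refl′ , refl′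
      where
      refl′ : ∀ {x} → x - x ≤ ι 0ℚ
      refl′ {x} = ≤-reflexive (≈⇒diff≈0 ≈-refl)
    walk-≤ in0 (suc n) = 
      ≤-resp (solve 3 (λ p q r → q :- p :+ (r :- q) := r :- p) ≈-refl _ _ _) n+1
        (+-mono-≤ (proj₁ (walk-≤ in0 n)) (direction-≤1 dir)) ,
      ≤-resp (solve 3 (λ p q r → p :- q :+ (:- (r :- q)) := p :- r) ≈-refl _ _ _) n+1
        (+-mono-≤ (proj₂ (walk-≤ in0 n)) (direction-≤1 (direction-negˡ dir)))
      where
      n+1 : ι (fromℕ n) + ι 1ℚ ≈ ι (fromℕ (suc n))
      n+1 = ≈-trans (solve 1 (λ n → n :+ con 1ℚ := con 1ℚ :+ n) ≈-refl _)
                    (≈-sym (ι-+ 1ℚ (fromℕ n)))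

      dir = unit⇒direction (f-unit in0 in0 (≈-trans
        (+-cong (*-cong (+-cong ≈-refl (-‿cong (≈-sym n+1)))
                        (+-cong ≈-refl (-‿cong (≈-sym n+1)))) ≈-refl)
        (solve 1 (λ n → (n :- (n :+ con 1ℚ)) :* (n :- (n :+ con 1ℚ)) :+
                        (con 0ℚ :- con 0ℚ) :* (con 0ℚ :- con 0ℚ) := con 1ℚ)
          ≈-refl (ι (fromℕ n)))))

    -- Displacements along the climb and the zigzag.

    module Slopes
      {c h c₁ a : Carrier} {A B k : ℕ}
      (0≤c : ι 0ℚ ≤ c) (c≉0 : ¬ c ≈ ι 0ℚ) (0≤h : ι 0ℚ ≤ h) (h≉0 : ¬ h ≈ ι 0ℚ)
      (0≤a : ι 0ℚ ≤ a) (a≤h : a ≤ h)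
      (u-dir : Direction c h) (w-dir : Direction c₁ a)
      (c+3≈4c₁ : c + ι 3ℚ ≈ ι 4ℚ * c₁)
      (A2c≈B : ι (fromℕ (suc A)) * (c + c) ≈ ι (fromℕ B))
      -- The climb has `k + 2` steps. Two levels must fit at least, since the auxiliary steps in
      -- `shift` carry points up to height `a + h`, which is at most `2h`.
      (kh≤ε₁ : ι (fromℕ (suc (suc k))) * h ≤ ε₁)
      (kh≰ε₂ : ¬ ι (fromℕ (suc (suc k))) * h ≤ ε₂)
      where

      c≉1 : ¬ c ≈ ι 1ℚ
      c≉1 c≈1 = h≉0 (square≈0 (combine₂ (ι 1ℚ) (- (c + ι 1ℚ)) u-dir c≈1
        (solve 2 (λ c h → h :* h :- con 0ℚ :=
          con 1ℚ :* (c :* c :+ h :* h :- con 1ℚ) :+ :- (c :+ con 1ℚ) :* (c :- con 1ℚ))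
          ≈-refl c h)))

      -- Nondegeneracy for `translate`, read off from first coordinates. Given `c + 3 = 4c₁`, the
      -- equation `c₁ = c` would force `c = 1`; in `c₁≉-c`, the equation `c₁ = − c` would force
      -- `c = − 3/5`.
      c₁≉c : ¬ c₁ ≈ c
      c₁≉c c₁≈c = c≉1 (combine₂ (ι (ℚ.- ⅓)) (ι (ℚ.- 4/3)) c+3≈4c₁ c₁≈c
        (solve 2 (λ c c₁ → c :- con 1ℚ :=
          con (ℚ.- ⅓) :* (c :+ con 3ℚ :- con 4ℚ :* c₁) :+ con (ℚ.- 4/3) :* (c₁ :- c))
          ≈-refl c c₁))
        where
        ⅓ = ℤ.+ 1 ℚ./ 3
        4/3 = ℤ.+ 4 ℚ./ 3

      nonNeg≉neg : ∀ {x} → ι 0ℚ ≤ x → ∀ q .{{_ : ℚ.Negative q}} → ¬ x ≈ ι q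
      nonNeg≉neg 0≤x q x≈q = ℚ.<-irrefl refl
        (ℚ.≤-<-trans (ι-cancel (≤-resp ≈-refl x≈q 0≤x)) (ℚ.negative⁻¹ q))

      c₁≉-c : ¬ c₁ ≈ - c
      c₁≉-c c₁≈-c = nonNeg≉neg 0≤c (ℚ.- ⅗) (combine₂ (ι ⅕) (ι ⅘) c+3≈4c₁ c₁≈-c
        (solve 2 (λ c c₁ → c :- con (ℚ.- ⅗) :=
          con ⅕ :* (c :+ con 3ℚ :- con 4ℚ :* c₁) :+ con ⅘ :* (c₁ :- :- c))
          ≈-refl c c₁))
        where
        ⅕ = ℤ.+ 1 ℚ./ 5
        ⅗ = ℤ.+ 3 ℚ./ 5
        ⅘ = ℤ.+ 4 ℚ./ 5

      -1≉c : ¬ ι (ℚ.- 1ℚ) ≈ c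
      -1≉c -1≈c = nonNeg≉neg 0≤c (ℚ.- 1ℚ) (≈-sym -1≈c)

      -1≉-c : ¬ ι (ℚ.- 1ℚ) ≈ - c
      -1≉-c -1≈-c = c≉1 (combine (ι 1ℚ) -1≈-c
        (solve 1 (λ c → c :- con 1ℚ := con 1ℚ :* (con (ℚ.- 1ℚ) :- :- c)) ≈-refl c))

      neg-fixed : ∀ {x} → - x ≈ x → x ≈ ι 0ℚ
      neg-fixed {x} eq = combine (ι (ℚ.- ½)) eq
        (solve 1 (λ x → x :- con 0ℚ := con (ℚ.- ½) :* (:- x :- x)) ≈-refl x)

      left-dir : Direction (ι (ℚ.- 1ℚ)) (ι 0ℚ)
      left-dir = solve 0 (con (ℚ.- 1ℚ) :* con (ℚ.- 1ℚ) :+ con 0ℚ :* con 0ℚ := con 1ℚ) ≈-refl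

      -- As 2c = 8c₁ − 6, the vector (2c , 0) is a sum of eight steps (c₁ , ± a)
      -- and six steps (− 1 , 0), none of which is parallel to (c , s).
      shift : ∀ {s x y} → Direction c s → In y → In (y + s) → In (y + a) → In (y + a + s) →
              step c s x y ≈² step c s (x + (c + c)) y
      shift {s} {x} {y} dir iny inys inya inyas =
        ≈²-trans (zigzag x) (≈²-trans (zigzag _) (≈²-trans (zigzag _) (≈²-trans (zigzag _)
        (≈²-trans (left _) (≈²-trans (left _) (≈²-trans (left _)
        (≈²-trans (left _) (≈²-trans (left _) (≈²-trans (left _)
        (step-cong iny inys
          (combine (ι (ℚ.- 2ℚ)) c+3≈4c₁ (solve 3 (λ x c c₁ →
            x :+ c₁ :+ c₁ :+ c₁ :+ c₁ :+ c₁ :+ c₁ :+ c₁ :+ c₁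
              :+ con (ℚ.- 1ℚ) :+ con (ℚ.- 1ℚ) :+ con (ℚ.- 1ℚ)
              :+ con (ℚ.- 1ℚ) :+ con (ℚ.- 1ℚ) :+ con (ℚ.- 1ℚ) :- (x :+ (c :+ c)) :=
            con (ℚ.- 2ℚ) :* (c :+ con 3ℚ :- con 4ℚ :* c₁)) ≈-refl x c c₁))
          ≈-refl))))))))))
        where
        y+a-a : y + a + - a ≈ y
        y+a-a = solve 2 (λ y a → y :+ a :+ :- a := y) ≈-refl y a

        y+0 : y + ι 0ℚ ≈ y
        y+0 = solve 1 (λ y → y :+ con 0ℚ := y) ≈-refl y

        in₁ = between-resp (≈-sym y+a-a) iny
        in₂ = between-resp (+-cong (≈-sym y+a-a) ≈-refl) inys
        in₃ = between-resp (≈-sym y+0) iny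
        in₄ = between-resp (+-cong (≈-sym y+0) ≈-refl) inys

        zigzag : ∀ x → step c s x y ≈² step c s (x + c₁ + c₁) y
        zigzag x = ≈²-trans
          (translate dir w-dir (c₁≉c ∘ proj₁) (c₁≉-c ∘ proj₁) iny inys inya inyas)
          (≈²-trans
            (translate dir (direction-negʳ w-dir) (c₁≉c ∘ proj₁) (c₁≉-c ∘ proj₁)
              inya inyas in₁ in₂)
            (step-cong in₁ in₂ ≈-refl y+a-a))

        left : ∀ x → step c s x y ≈² step c s (x + ι (ℚ.- 1ℚ)) y
        left x = ≈²-trans
          (translate dir left-dir (-1≉c ∘ proj₁) (-1≉-c ∘ proj₁) iny inys in₃ in₄)
          (step-cong in₃ in₄ ≈-refl y+0)

      height : ℕ → Carrier
      height n = ι (fromℕ n) * h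

      height-suc : ∀ n → height n + h ≈ height (suc n)
      height-suc n = ≈-sym (times-suc n h)

      height-in : ∀ {n} → n ℕ.≤ suc (suc k) → In (height n)
      height-in {n} n≤ = times-nonNeg n 0≤h , ≤-trans (times-mono 0≤h n≤) kh≤ε₁

      times-zero : ∀ {x} → ι (fromℕ 0) * x ≈ ι 0ℚ
      times-zero {x} = solve 1 (λ x → con 0ℚ :* x := con 0ℚ) ≈-refl x

      height-in-suc : ∀ {n} → suc n ℕ.≤ suc (suc k) → In (height n + h)
      height-in-suc {n} n< = between-resp (≈-sym (height-suc n)) (height-in n<)

      in0 : In (ι 0ℚ)
      in0 = between-resp times-zero (height-in ℕ.z≤n)

      -- The displacements φ and ψ. The step of `ū` starts where that of `u` ends, so `u + ū` is the
      -- displacement over the first period of the zigzag.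
      u ū : Point
      u = step c h (ι 0ℚ) (ι 0ℚ)
      ū = step c (- h) (ι 0ℚ + c) (ι 0ℚ + h)

      in-h : In (ι 0ℚ + h)
      in-h = between-resp (+-cong times-zero ≈-refl) (height-in-suc (ℕ.s≤s ℕ.z≤n))

      in-h-h : In (ι 0ℚ + h + - h)
      in-h-h = between-resp (solve 1 (λ h → con 0ℚ := con 0ℚ :+ h :+ :- h) ≈-refl h) in0

      in-+a : ∀ {n} → suc n ℕ.≤ suc (suc k) → In (height n + a)
      in-+a {n} n< = +-nonNeg (proj₁ (height-in (ℕ.<⇒≤ n<))) 0≤a ,
        ≤-trans (+-mono-≤ ≤-refl a≤h) (proj₂ (height-in-suc n<))

      in-+a+h : ∀ {n} → suc (suc n) ℕ.≤ suc (suc k) → In (height n + a + h)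
      in-+a+h {n} n< = +-nonNeg (proj₁ (in-+a (ℕ.<⇒≤ n<))) 0≤h ,
        ≤-trans (+-mono-≤ (≤-trans (+-mono-≤ ≤-refl a≤h) (≤-reflexive (height-suc n))) ≤-refl)
                (proj₂ (height-in-suc n<))

      -- `translate` does not allow moving a step along itself, so the move by `(c , h)` is made as
      -- `(2c , 0)` by `shift`, followed by `(− c , h)`.
      climb-step : ∀ n → suc n ℕ.≤ suc (suc k) →
                   step c h (ι (fromℕ n) * c) (height n) ≈² u
      climb-step zero n< = step-cong (height-in ℕ.z≤n) (height-in-suc n<) times-zero times-zero
      climb-step (suc n) n< = ≈²-trans (≈²-sym
        (≈²-trans (shift u-dir (height-in (ℕ.<⇒≤ n<′)) (height-in-suc n<′) (in-+a n<′) (in-+a+h n<))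
        (≈²-trans (translate u-dir (direction-negˡ u-dir)
          (λ (eq , _) → c≉0 (neg-fixed eq)) (λ (_ , eq) → h≉0 (neg-fixed (≈-sym eq)))
          (height-in (ℕ.<⇒≤ n<′)) (height-in-suc n<′) (height-in-suc n<′) in-2h)
        (step-cong (height-in-suc n<′) in-2h
          (combine (ι (ℚ.- 1ℚ)) (times-suc n c)
            (solve 3 (λ m n c → n :* c :+ (c :+ c) :+ :- c :- m :* c :=
              con (ℚ.- 1ℚ) :* (m :* c :- (n :* c :+ c))) ≈-refl _ _ _))
          (height-suc n)))))
        (climb-step n n<′)
        where
        n<′ = ℕ.<⇒≤ n<
        in-2h : In (height n + h + h)
        in-2h = between-resp (+-cong (≈-sym (height-suc n)) ≈-refl) (height-in-suc n<)

      climb : ∀ n → n ℕ.≤ suc (suc k) →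
              proj₂ (f (ι (fromℕ n) * c , height n)) - proj₂ (f (ι 0ℚ , ι 0ℚ)) ≈
              ι (fromℕ n) * proj₂ u
      climb zero n≤ = ≈-trans
        (≈⇒diff≈0 (proj₂ (f-cong (height-in n≤) (times-zero , times-zero))))
        (≈-sym times-zero)
      climb (suc n) n< = ≈-trans
        (+-cong (proj₂ (f-cong (height-in n<) (times-suc n c , times-suc n h))) ≈-refl)
        (combine₂ (ι 1ℚ) (ι 1ℚ) (climb n (ℕ.<⇒≤ n<)) (proj₂ (climb-step n n<))
          (≈-trans (+-cong ≈-refl (-‿cong (times-suc n (proj₂ u))))
          (solve 5 (λ p q r m v → r :- p :- (m :* v :+ v) :=
            con 1ℚ :* (q :- p :- m :* v) :+ con 1ℚ :* (r :- q :- v)) ≈-refl _ _ _ _ _)))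

      zigzag-x : ℕ → Carrier
      zigzag-x n = ι (fromℕ n) * (c + c)

      zigzag-up : ∀ n → step c h (zigzag-x n) (ι 0ℚ) ≈² u
      zigzag-up zero = step-cong in0 in-h times-zero ≈-refl
      zigzag-up (suc n) = ≈²-trans (≈²-sym (≈²-trans
        (shift u-dir in0 in-h
          (between-resp (+-cong times-zero ≈-refl) (in-+a (ℕ.s≤s ℕ.z≤n)))
          (between-resp (+-cong (+-cong times-zero ≈-refl) ≈-refl)
            (in-+a+h (ℕ.s≤s (ℕ.s≤s ℕ.z≤n)))))
        (step-cong in0 in-h (≈-sym (times-suc n (c + c))) ≈-refl)))
        (zigzag-up n)

      -- A period is the vector `(2c , 0)`, so `shift` carries each descent to the next one.
      -- Descents start at height `h`, and the auxiliary steps rise from there to `h + a`.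
      zigzag-down : ∀ n → step c (- h) (zigzag-x n + c) (ι 0ℚ + h) ≈² ū
      zigzag-down zero = step-cong in-h in-h-h (+-cong times-zero ≈-refl) ≈-refl
      zigzag-down (suc n) = ≈²-trans (≈²-sym (≈²-trans
        (shift (direction-negʳ u-dir) in-h in-h-h
          (between-resp (solve 2 (λ a h → con 0ℚ :* h :+ a :+ h := con 0ℚ :+ h :+ a) ≈-refl a h)
            (in-+a+h (ℕ.s≤s (ℕ.s≤s ℕ.z≤n))))
          (between-resp (solve 2 (λ a h → con 0ℚ :* h :+ a := con 0ℚ :+ h :+ a :+ :- h) ≈-refl a h)
            (in-+a (ℕ.s≤s ℕ.z≤n))))
        (step-cong in-h in-h-h
          (combine (ι (ℚ.- 1ℚ)) (times-suc n (c + c))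
            (solve 3 (λ m n c → n :* (c :+ c) :+ c :+ (c :+ c) :- (m :* (c :+ c) :+ c) :=
              con (ℚ.- 1ℚ) :* (m :* (c :+ c) :- (n :* (c :+ c) :+ (c :+ c)))) ≈-refl _ _ _))
          ≈-refl)))
        (zigzag-down n)

      u₁ = proj₁ u
      u₂ = proj₂ u
      ū₁ = proj₁ ū
      ū₂ = proj₂ ū

      base : Point
      base = f (ι 0ℚ , ι 0ℚ)

      f-zigzag : ∀ n → let p = f (zigzag-x n , ι 0ℚ) in
                 proj₁ p - proj₁ base ≈ ι (fromℕ n) * (u₁ + ū₁) ×
                 proj₂ p - proj₂ base ≈ ι (fromℕ n) * (u₂ + ū₂)
      f-zigzag zero =
        ≈-trans (≈⇒diff≈0 (proj₁ (f-cong in0 (times-zero , ≈-refl)))) (≈-sym times-zero) ,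
        ≈-trans (≈⇒diff≈0 (proj₂ (f-cong in0 (times-zero , ≈-refl)))) (≈-sym times-zero)
      f-zigzag (suc n) =
        advance (proj₁ p≈) (proj₁ (f-zigzag n)) (proj₁ (zigzag-up n)) (proj₁ (zigzag-down n)) ,
        advance (proj₂ p≈) (proj₂ (f-zigzag n)) (proj₂ (zigzag-up n)) (proj₂ (zigzag-down n))
        where
        p≈ = f-cong in0
          ( combine (ι 1ℚ) (times-suc n (c + c))
              (solve 3 (λ m n c → m :* (c :+ c) :- (n :* (c :+ c) :+ c :+ c) :=
                con 1ℚ :* (m :* (c :+ c) :- (n :* (c :+ c) :+ (c :+ c)))) ≈-refl _ _ _)
          , solve 1 (λ h → con 0ℚ := con 0ℚ :+ h :+ :- h) ≈-refl h)

        advance : ∀ {b p q r s v w} → s ≈ r → p - b ≈ ι (fromℕ n) * (v + w) →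
                  q - p ≈ v → r - q ≈ w → s - b ≈ ι (fromℕ (suc n)) * (v + w)
        advance {b} {p} {q} {r} {s} {v} {w} s≈r eq v≈ w≈ = ≈-trans (+-cong s≈r ≈-refl)
          (≈-trans (combine₂ (ι 1ℚ) (ι 1ℚ) eq (+-cong v≈ w≈)
            (solve 7 (λ b p q r n v w → r :- b :- (n :* (v :+ w) :+ (v :+ w)) :=
              con 1ℚ :* (p :- b :- n :* (v :+ w)) :+ con 1ℚ :* (q :- p :+ (r :- q) :- (v :+ w)))
              ≈-refl b p q r (ι (fromℕ n)) v w))
          (≈-sym (times-suc n (v + w))))

      negate-diff : ∀ {x y z} n → y - x ≈ n * z → x - y ≈ n * (- z)
      negate-diff {x} {y} {z} n eq = combine (ι (ℚ.- 1ℚ)) eq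
        (solve 4 (λ x y z n → x :- y :- n :* (:- z) := con (ℚ.- 1ℚ) :* (y :- x :- n :* z))
          ≈-refl x y z n)

      -- After `n` periods the image has risen by `n (u₂ + ū₂)`, yet it stays in a strip of width
      -- `ε₂`. The Archimedean property is applied to both signs.
      u₂+ū₂≈0 : u₂ + ū₂ ≈ ι 0ℚ
      u₂+ū₂≈0 = ≤-antisym
        (archimedean λ n → ≤-resp (proj₂ (f-zigzag n)) ≈-refl
          (between-diff (f-strip in0) (f-strip in0)))
        (≤-from (neg-nonNeg (archimedean λ n →
          ≤-resp (negate-diff _ (proj₂ (f-zigzag n))) ≈-refl
            (between-diff (f-strip in0) (f-strip in0))))
          (solve 1 (λ x → x :- con 0ℚ := :- :- x) ≈-refl _))

      -- Compares speeds: `(A + 1) w = d ≤ B = (A + 1) 2c`, and the factor `A + 1` cancels.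
      slower : ∀ {d w} → d ≈ ι (fromℕ (suc A)) * w → d ≤ ι (fromℕ B) → ι 0ℚ ≤ c + c - w
      slower {d} {w} d≈ d≤B = times-cancel-nonNeg A (≤-resp ≈-refl
        (combine₂ (ι (ℚ.- 1ℚ)) (ι (ℚ.- 1ℚ)) A2c≈B d≈
          (solve 5 (λ b d n x w → b :- d :- n :* (x :- w) :=
            con (ℚ.- 1ℚ) :* (n :* x :- b) :+ con (ℚ.- 1ℚ) :* (d :- n :* w))
            ≈-refl (ι (fromℕ B)) d (ι (fromℕ (suc A))) (c + c) w))
        (≤⇒0≤diff d≤B))

      -- The end of the zigzag is also reached by B horizontal steps.
      f-end : proj₁ (f (ι (fromℕ B) , ι 0ℚ)) - proj₁ base ≈ ι (fromℕ (suc A)) * (u₁ + ū₁)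
      f-end = ≈-trans
        (+-cong (≈-sym (proj₁ (f-cong {zigzag-x (suc A) , ι 0ℚ} in0 (A2c≈B , ≈-refl)))) ≈-refl)
        (proj₁ (f-zigzag (suc A)))

      -- Otherwise one period of the zigzag would have a closed image, and `f` would identify
      -- `(2c , 0)` with the origin.
      u₁+ū₁≉0 : ¬ u₁ + ū₁ ≈ ι 0ℚ
      u₁+ū₁≉0 eq = c≉0 (combine₂ (ι ½) (ι (ℚ.- ½)) (proj₁ closed) (times-suc 0 (c + c))
        (solve 2 (λ m c → c :- con 0ℚ := con ½ :* (m :* (c :+ c) :- con 0ℚ) :+
          con (ℚ.- ½) :* (m :* (c :+ c) :- (con 0ℚ :* (c :+ c) :+ (c :+ c)))) ≈-refl _ c))
        where
        return : ∀ {x y z n} → x - y ≈ n * z → z ≈ ι 0ℚ → x ≈ y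
        return {x} {y} {z} {n} x-y≈ z≈0 = combine₂ (ι 1ℚ) n x-y≈ z≈0
          (solve 4 (λ x y z n → x :- y := con 1ℚ :* (x :- y :- n :* z) :+ n :* (z :- con 0ℚ))
            ≈-refl x y z n)

        closed : (zigzag-x 1 , ι 0ℚ) ≈² (ι 0ℚ , ι 0ℚ)
        closed = f-inj in0 in0
          (return (proj₁ (f-zigzag 1)) eq , return (proj₂ (f-zigzag 1)) u₂+ū₂≈0)

      u-image-dir : Direction u₁ u₂
      u-image-dir = step-direction u-dir in0 in-h

      ū-image-dir : Direction ū₁ ū₂
      ū-image-dir = step-direction (direction-negʳ u-dir) in-h in-h-h

      -- The images are unit vectors with opposite second coordinates, so their first coordinates
      -- have equal squares; opposite signs are excluded by `u₁+ū₁≉0`.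
      u₁≈ū₁ : u₁ ≈ ū₁
      u₁≈ū₁ = [ diff≈0⇒≈ , ⊥-elim ∘ u₁+ū₁≉0 ]′ (integral
        (combine₂ (ι 1ℚ) (ū₂ - u₂) (≈-trans u-image-dir (≈-sym ū-image-dir)) u₂+ū₂≈0
          (solve 4 (λ u₁ u₂ v₁ v₂ → (u₁ :- v₁) :* (u₁ :+ v₁) :- con 0ℚ :=
            con 1ℚ :* (u₁ :* u₁ :+ u₂ :* u₂ :- (v₁ :* v₁ :+ v₂ :* v₂)) :+
            (v₂ :- u₂) :* (u₂ :+ v₂ :- con 0ℚ)) ≈-refl u₁ u₂ ū₁ ū₂)))

      -- Both vectors being of length 1, `u₂² − h² = (c − u₁) (c + u₁)`. The factors are nonnegative
      -- because `2u₁ = u₁ + ū₁` lies between `− 2c` and `2c`.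
      h²≤u₂² : ι 0ℚ ≤ u₂ * u₂ - h * h
      h²≤u₂² = ≤-resp ≈-refl
        (combine₂ (ι (ℚ.- 1ℚ)) (ι 1ℚ) u-image-dir u-dir
          (solve 4 (λ c h u₁ u₂ → (c :- u₁) :* (c :+ u₁) :- (u₂ :* u₂ :- h :* h) :=
            con (ℚ.- 1ℚ) :* (u₁ :* u₁ :+ u₂ :* u₂ :- con 1ℚ) :+
            con 1ℚ :* (c :* c :+ h :* h :- con 1ℚ)) ≈-refl c h u₁ u₂))
        (*-nonNeg
          (≤-resp ≈-refl
            (combine (ι ½) u₁≈ū₁ (solve 3 (λ c u v →
              con ½ :* (c :+ c :- (u :+ v)) :- (c :- u) := con ½ :* (u :- v)) ≈-refl c u₁ ū₁))
            (*-nonNeg (ι-mono (ℚ.nonNegative⁻¹ ½)) (slower f-end (proj₁ (walk-≤ in0 B)))))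
          (≤-resp ≈-refl
            (combine (ι (ℚ.- ½)) u₁≈ū₁ (solve 3 (λ c u v →
              con ½ :* (c :+ c :- :- (u :+ v)) :- (c :+ u) := con (ℚ.- ½) :* (u :- v))
              ≈-refl c u₁ ū₁))
            (*-nonNeg (ι-mono (ℚ.nonNegative⁻¹ ½))
              (slower (negate-diff _ f-end) (proj₂ (walk-≤ in0 B))))))

      absurd : ⊥
      -- The ends of the climb have images whose heights differ by `K |u₂| ≥ K h`, but by at most
      -- `ε₂`. A descending image exchanges the roles of the two ends.
      absurd = [ (λ 0≤u₂ → kh≰ε₂ (≤-trans
                   (times-mono₂ K (square-cancel-≤ 0≤h 0≤u₂ h²≤u₂²))
                   (≤-resp (climb K ℕ.≤-refl) ≈-refl (between-diff top bottom))))
               , (λ u₂≤0 → kh≰ε₂ (≤-trans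
                   (times-mono₂ K (square-cancel-≤ 0≤h (neg-nonNeg u₂≤0)
                     (≤-resp ≈-refl (solve 2 (λ u h →
                       u :* u :- h :* h := :- u :* :- u :- h :* h) ≈-refl u₂ h) h²≤u₂²)))
                   (≤-resp (negate-diff _ (climb K ℕ.≤-refl)) ≈-refl (between-diff bottom top)))) ]′
                 (total (ι 0ℚ) u₂)
        where
        K      = suc (suc k)
        top    = f-strip (height-in {K} ℕ.≤-refl)
        bottom = f-strip in0

    -- Some multiple of `h` exceeds `b`, as otherwise `archimedean` would give `h ≤ 0`. Descending
    -- from that multiple meets the last one within `b`.
    lastWithin : ExcludedMiddle 0ℓ → ∀ {h b} → ι 0ℚ ≤ h → ¬ h ≈ ι 0ℚ → ι 0ℚ ≤ b →
                 ∃[ n ] ι (fromℕ n) * h ≤ b × ¬ ι (fromℕ (suc n)) * h ≤ b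
    lastWithin em {h} {b} 0≤h h≉0 0≤b = case em {∃[ n ] ¬ P n} of
      λ where
        (yes (n , ¬Pn)) → search n ¬Pn
        (no ∄n) → ⊥-elim (h≉0 (≤-antisym
          (archimedean λ n → decidable-stable em (λ ¬Pn → ∄n (n , ¬Pn))) 0≤h))
      where
      P : ℕ → Set
      P n = ι (fromℕ n) * h ≤ b

      search : ∀ n → ¬ P n → ∃[ n ] P n × ¬ P (suc n)
      search zero    ¬P0 = ⊥-elim (¬P0
        (≤-resp (solve 1 (λ h → con 0ℚ := con 0ℚ :* h) ≈-refl h) ≈-refl 0≤b))
      search (suc n) ¬Pn = case em {P n} of λ where
          (yes Pn)  → n , Pn , ¬Pn
          (no ¬Pn′) → search n ¬Pn′

    -- The climb gets the largest number `n` of steps with `n h ≤ ε₁`. If also `n h ≤ ε₂`, one more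
    -- step would still fit, because `h ≤ δ` and `ε₂ + δ ≤ ε₁`.
    noEmbedding : ExcludedMiddle 0ℓ → ι 0ℚ ≤ ε₂ → ∀ {δ} → 0ℚ ℚ.< δ → ¬ ε₂ + ι δ ≤ ε₁
    noEmbedding em 0≤ε₂ {δ} 0<δ ε₂+δ≤ε₁ =
      case lastWithin em (nonNeg 0<h) (nonZero 0<h) 0≤ε₁ of λ where
        -- Fewer than two steps are impossible, since `2h ≤ δ ≤ ε₁`.
        (zero , _ , 1h≰ε₁) → 1h≰ε₁ (≤-trans (times-mono (nonNeg 0<h) (ℕ.s≤s (ℕ.z≤n {1}))) 2h≤ε₁)
        (suc zero , _ , 2h≰ε₁) → 2h≰ε₁ 2h≤ε₁
        (suc (suc k) , kh≤ε₁ , k+1h≰ε₁) →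
          Slopes.absurd {A = proj₁ cleared} {B = proj₁ (proj₂ cleared)} {k = k}
            (nonNeg 0<c) (nonZero 0<c) (nonNeg 0<h) (nonZero 0<h) (ι-mono 0≤a) (ι-mono a≤h)
            (direction c²+h²≡1) (direction c₁²+a²≡1)
            (≈-trans (≈-sym (ι-+ c 3ℚ)) (≈-trans (ι-cong c+3≡4c₁) (ι-* 4ℚ c₁)))
            (≈-trans (*-cong ≈-refl (≈-sym (ι-+ c c)))
              (≈-trans (≈-sym (ι-* (fromℕ (suc (proj₁ cleared))) (c ℚ.+ c)))
                (ι-cong (proj₂ (proj₂ cleared)))))
            kh≤ε₁
            (λ kh≤ε₂ → k+1h≰ε₁ (≤-resp (≈-sym (times-suc (suc (suc k)) (ι h))) ≈-refl
              (≤-trans (+-mono-≤ kh≤ε₂ (ι-mono h≤δ)) ε₂+δ≤ε₁)))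
      where
      open RationalSlopes (rationalSlopes 0<δ)

      ι-cong : ∀ {p q} → p ≡ q → ι p ≈ ι q
      ι-cong refl = ≈-refl

      nonNeg : ∀ {q} → 0ℚ ℚ.< q → ι 0ℚ ≤ ι q
      nonNeg 0<q = ι-mono (ℚ.<⇒≤ 0<q)

      nonZero : ∀ {q} → 0ℚ ℚ.< q → ¬ ι q ≈ ι 0ℚ
      nonZero 0<q q≈0 = ℚ.<-irrefl refl (ℚ.<-≤-trans 0<q (ι-cancel (≤-reflexive q≈0)))

      direction : ∀ {p q} → p ℚ.* p ℚ.+ q ℚ.* q ≡ 1ℚ → Direction (ι p) (ι q)
      direction {p} {q} eq = ≈-trans (+-cong (≈-sym (ι-* p p)) (≈-sym (ι-* q q)))
        (≈-trans (≈-sym (ι-+ (p ℚ.* p) (q ℚ.* q))) (ι-cong eq))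

      cleared = clear-denominator (c ℚ.+ c) (ℚ.<⇒≤ (ℚ.+-mono-< 0<c 0<c))

      δ≤ε₁ : ι δ ≤ ε₁
      δ≤ε₁ = ≤-trans (≤-resp (solve 1 (λ δ → con 0ℚ :+ δ := δ) ≈-refl (ι δ)) ≈-refl
        (+-mono-≤ 0≤ε₂ ≤-refl)) ε₂+δ≤ε₁

      0≤ε₁ : ι 0ℚ ≤ ε₁
      0≤ε₁ = ≤-trans (nonNeg 0<δ) δ≤ε₁

      h≤δ : h ℚ.≤ δ
      h≤δ = ℚ.≤-trans (≤-from-diff (ℚ.<⇒≤ 0<h) refl) 2h≤δ

      2h≤ε₁ : ι (fromℕ 2) * ι h ≤ ε₁
      2h≤ε₁ = ≤-trans (≤-reflexive (≈-trans
        (solve 1 (λ h → con (fromℕ 2) :* h := h :+ h) ≈-refl (ι h))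
        (≈-sym (ι-+ h h)))) (≤-trans (ι-mono 2h≤δ) δ≤ε₁)

  -- From maps on the strip to maps on the plane.

  Strip : Carrier → Set
  Strip ε = Σ Point (Between ε ∘ proj₂)

  noStripEmbedding : ExcludedMiddle 0ℓ →
    ∀ {ε₁ ε₂ δ} → ι 0ℚ ≤ ε₂ → 0ℚ ℚ.< δ → ε₂ + ι δ ≤ ε₁ →
    (g : Strip ε₁ → Strip ε₂) →
    (∀ {p q} → proj₁ p ≈² proj₁ q → proj₁ (g p) ≈² proj₁ (g q)) →
    (∀ {p q} → Unit (proj₁ p) (proj₁ q) → Unit (proj₁ (g p)) (proj₁ (g q))) →
    ¬ (∀ {p q} → proj₁ (g p) ≈² proj₁ (g q) → proj₁ p ≈² proj₁ q)
  noStripEmbedding em {ε₁} {ε₂} 0≤ε₂ 0<δ gap g g-cong g-unit g-inj =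
    Homomorphism.noEmbedding ε₁ ε₂ f
      (λ inp p≈q → ≈²-trans (f≈g inp) (≈²-trans (g-cong p≈q)
        (≈²-sym (f≈g (between-resp (proj₂ p≈q) inp)))))
      (λ {p} inp → between-resp (≈-sym (proj₂ (f≈g inp))) (proj₂ (g (p , inp))))
      (λ inp inq unit → unit-resp (≈²-sym (f≈g inp)) (≈²-sym (f≈g inq)) (g-unit unit))
      (λ inp inq fp≈fq → g-inj (≈²-trans (≈²-sym (f≈g inp)) (≈²-trans fp≈fq (f≈g inq))))
      em 0≤ε₂ 0<δ gap
    where
    extend : ∀ p → Dec (Between ε₁ (proj₂ p)) → Point
    extend p (yes inp) = proj₁ (g (p , inp))
    -- An arbitrary value: the hypotheses of `Homomorphism` constrain `f` only at points of the
    -- strip.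
    extend p (no _)    = p

    f : Point → Point
    f p = extend p em

    f≈g : ∀ {p} (inp : Between ε₁ (proj₂ p)) → f p ≈² proj₁ (g (p , inp))
    f≈g {p} inp with em {Between ε₁ (proj₂ p)}
    -- The membership proof found by `em` may differ from `inp`; `g-cong` compares points only.
    ... | yes _   = g-cong ≈²-refl
    ... | no ¬inp = ⊥-elim (¬inp inp)

-- The real numbers as an Archimedean domain

open import Defs

private

  infixr 2 _&_

  _&_ : ∀ {P Q} → Eventually P → Eventually Q → Eventually (λ n → P n × Q n)
  (M , p) & (N , q) = M ℕ.⊔ N , λ n le →
    p n (ℕ.m⊔n≤o⇒m≤o M N le) , q n (ℕ.m⊔n≤o⇒n≤o M N le)

  infixl 1 _⟨&⟩_

  _⟨&⟩_ : ∀ {P Q : ℕ → Set} → Eventually P → (∀ n → P n → Q n) → Eventually Q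
  (N , p) ⟨&⟩ f = N , λ n le → f n (p n le)

  never : ∀ {P : ℕ → Set} → Eventually P → ¬ (∀ n → ¬ P n)
  never (N , p) ¬p = ¬p N (p N ℕ.≤-refl)

-- Inequalities between Cauchy sequences.

module _ where

  open ℚSolver using (solve; con; _:+_; _:-_; _:*_; :-_; _:=_)

  <-shift : ∀ {p q r s} t → p ℚ.< q → r ≡ p ℚ.+ t → s ≡ q ℚ.+ t → r ℚ.< s
  <-shift t p<q refl refl = ℚ.+-monoˡ-< t p<q

  p<p+ε : ∀ p {ε} → 0ℚ ℚ.< ε → p ℚ.< p ℚ.+ ε
  p<p+ε p 0<ε = <-shift p 0<ε (≡.sym (ℚ.+-identityˡ p)) (ℚ.+-comm p _)

  ε/2 : ∀ {ε} → 0ℚ ℚ.< ε → 0ℚ ℚ.< ½ ℚ.* ε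
  ε/2 = pos-* (ℚ.positive⁻¹ ½)

  p≤∣p∣ : ∀ p → p ℚ.≤ ∣ p ∣
  p≤∣p∣ p = [ (λ 0≤p → ℚ.≤-reflexive (≡.sym (ℚ.0≤p⇒∣p∣≡p 0≤p)))
            , (λ p≤0 → ℚ.≤-trans p≤0 (ℚ.0≤∣p∣ p)) ]′ (ℚ.≤-total 0ℚ p)

  ∣p-q∣<ε⇒p<q+ε : ∀ {p q ε} → ∣ p ℚ.- q ∣ ℚ.< ε → p ℚ.< q ℚ.+ ε
  ∣p-q∣<ε⇒p<q+ε {p} {q} {ε} lt = <-shift q (ℚ.≤-<-trans (p≤∣p∣ (p ℚ.- q)) lt)
    (solve 2 (λ p q → p := p :- q :+ q) refl p q) (ℚ.+-comm q ε)

  ∣p-q∣<ε⇒q<p+ε : ∀ {p q ε} → ∣ p ℚ.- q ∣ ℚ.< ε → q ℚ.< p ℚ.+ ε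
  ∣p-q∣<ε⇒q<p+ε {p} {q} {ε} lt = ∣p-q∣<ε⇒p<q+ε {q} {p}
    (subst (ℚ._< ε) (≡.trans (≡.sym (ℚ.∣-p∣≡∣p∣ (p ℚ.- q)))
      (cong ∣_∣ (solve 2 (λ p q → :- (p :- q) := q :- p) refl p q))) lt)

  p<q+ε⇒∣p-q∣<ε : ∀ {p q ε} → p ℚ.< q ℚ.+ ε → q ℚ.< p ℚ.+ ε → ∣ p ℚ.- q ∣ ℚ.< ε
  p<q+ε⇒∣p-q∣<ε {p} {q} {ε} p< q< =
    [ (λ eq → subst (ℚ._< ε) (≡.sym eq)
        (<-shift (ℚ.- q) p< refl (solve 2 (λ q ε → ε := q :+ ε :- q) refl q ε)))
    , (λ eq → subst (ℚ._< ε) (≡.sym eq)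
        (<-shift (ℚ.- p) q< (solve 2 (λ p q → :- (p :- q) := q :- p) refl p q)
          (solve 2 (λ p ε → ε := p :+ ε :- p) refl p ε))) ]′
    (ℚ.∣p∣≡p∨∣p∣≡-p (p ℚ.- q))

  <-trans-half : ∀ {p q r} ε → p ℚ.< q ℚ.+ ½ ℚ.* ε → q ℚ.< r ℚ.+ ½ ℚ.* ε → p ℚ.< r ℚ.+ ε
  <-trans-half {p} {q} {r} ε p< q< = ℚ.<-trans p<
    (<-shift (½ ℚ.* ε) q< refl
      (solve 2 (λ r ε → r :+ ε := r :+ con ½ :* ε :+ con ½ :* ε) refl r ε))

  fromℕ-nonNeg : ∀ n → 0ℚ ℚ.≤ fromℕ n
  fromℕ-nonNeg zero    = ℚ.≤-refl
  fromℕ-nonNeg (suc n) = ℚ.+-mono-≤ (ℚ.nonNegative⁻¹ 1ℚ) (fromℕ-nonNeg n)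

  -- For `q ≥ 0` with `(A + 1) q = B`, the numerator `B` is already at least `q`.
  natAbove : ∀ q → ∃[ n ] q ℚ.≤ fromℕ n
  natAbove q with ℚ.≤-total 0ℚ q
  ... | inj₂ q≤0 = 0 , q≤0
  ... | inj₁ 0≤q =
    let A , B , Aq≡B = clear-denominator q 0≤q
    in B , ≤-from-diff (nonNeg-* (fromℕ-nonNeg A) 0≤q)
             (≡.trans (≡.sym Aq≡B)
               (solve 2 (λ a q → (con 1ℚ :+ a) :* q := q :+ a :* q) refl (fromℕ A) q))

  natMultipleAbove : ∀ M {η} → 0ℚ ℚ.< η → ∃[ n ] M ℚ.≤ fromℕ n ℚ.* η
  natMultipleAbove M {η} 0<η =
    let n , M/η≤n = natAbove (M ℚ.* ℚ.1/ η)
    in n , subst (ℚ._≤ fromℕ n ℚ.* η)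
      (≡.trans (ℚ.*-assoc M (ℚ.1/ η) η)
        (≡.trans (cong (M ℚ.*_) (ℚ.*-inverseˡ η)) (ℚ.*-identityʳ M)))
      (ℚ.*-monoʳ-≤-nonNeg η {{ℚ.pos⇒nonNeg η}} M/η≤n)
    where
    instance
      η-pos : ℚ.Positive η
      η-pos = ℚ.positive 0<η
      η-nonZero : ℚ.NonZero η
      η-nonZero = ℚ.pos⇒nonZero η

  ≤-refl-≃ : ∀ {x y} → x ≃ y → x ≤ y
  ≤-refl-≃ {x} {y} x≃y ε 0<ε = x≃y ε 0<ε ⟨&⟩ λ n → ∣p-q∣<ε⇒p<q+ε {seq x n} {seq y n}

  ≤-trans-ℝ : ∀ {x y z} → x ≤ y → y ≤ z → x ≤ z
  ≤-trans-ℝ {x} {y} {z} x≤y y≤z ε 0<ε = x≤y _ (ε/2 0<ε) & y≤z _ (ε/2 0<ε) ⟨&⟩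
    λ n (p , q) → <-trans-half {seq x n} {seq y n} {seq z n} ε p q

  ≤-antisym-ℝ : ∀ {x y} → x ≤ y → y ≤ x → x ≃ y
  ≤-antisym-ℝ {x} {y} x≤y y≤x ε 0<ε = x≤y ε 0<ε & y≤x ε 0<ε ⟨&⟩
    λ n (p , q) → p<q+ε⇒∣p-q∣<ε {seq x n} {seq y n} p q

  +-monoʳ-≤-ℝ : ∀ z {x y} → x ≤ y → z + x ≤ z + y
  +-monoʳ-≤-ℝ z {x} {y} x≤y ε 0<ε = x≤y ε 0<ε ⟨&⟩ λ n lt → <-shift (seq z n) lt
    (ℚ.+-comm (seq z n) (seq x n))
    (solve 3 (λ z y ε → z :+ y :+ ε := y :+ ε :+ z) refl (seq z n) (seq y n) ε)

  fromℚ-mono : ∀ {p q} → p ℚ.≤ q → fromℚ p ≤ fromℚ q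
  fromℚ-mono {p} {q} p≤q ε 0<ε = 0 , λ _ _ → ℚ.≤-<-trans p≤q (p<p+ε q 0<ε)

  -- If `q < p`, the tolerance `p − q` turns the hypothesis into `p < p`.
  fromℚ-cancel : ∀ {p q} → fromℚ p ≤ fromℚ q → p ℚ.≤ q
  fromℚ-cancel {p} {q} p≤q with p ℚ.≤? q
  ... | yes le  = le
  ... | no  nle = ⊥-elim (never
    (p≤q (p ℚ.- q) (<-shift (ℚ.- q) (ℚ.≰⇒> nle) (≡.sym (ℚ.+-inverseʳ q)) refl))
    λ _ lt → ℚ.<-irrefl (solve 2 (λ p q → p := q :+ (p :- q)) refl p q) lt)

  <⇒≤-ℝ : ∀ {x y} → x < y → x ≤ y
  <⇒≤-ℝ {x} {y} (η , 0<η , ev) ε 0<ε = ev ⟨&⟩ λ n lt →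
    ℚ.<-trans (ℚ.<-trans (p<p+ε (seq x n) 0<η) lt) (p<p+ε (seq y n) 0<ε)

  <⇒≱-ℝ : ∀ {x y} → x < y → ¬ y ≤ x
  <⇒≱-ℝ (η , 0<η , ev) y≤x = never (ev & y≤x η 0<η) λ _ (p , q) → ℚ.<-asym p q

  <⇒gap : ∀ {x y} → x < y → ∃[ δ ] 0ℚ ℚ.< δ × x + fromℚ δ ≤ y
  <⇒gap {x} {y} (δ , 0<δ , ev) = δ , 0<δ , λ ε 0<ε → ev ⟨&⟩ λ n lt →
    ℚ.<-trans lt (p<p+ε (seq y n) 0<ε)

-- Trichotomy and its consequences, by excluded middle.

module _ (em : ExcludedMiddle 0ℓ) where

  open ℚSolver using (solve; con; _:+_; _:-_; _:*_; :-_; _:=_)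

  -- If `x` is not zero, some `ε` is reached by `|xₙ|` beyond every index. Taking such an `n` past
  -- the Cauchy index for `ε/2`, all later terms lie within `ε/2` of `xₙ`; they keep its sign and
  -- stay `ε/2` away from zero.
  sign : ∀ x → x ≃ 0ℝ ⊎ 0ℝ < x ⊎ x < 0ℝ
  sign x with em {x ≃ 0ℝ}
  ... | yes x≃0 = inj₁ x≃0
  ... | no x≄0 with em {∃[ ε ] 0ℚ ℚ.< ε × ¬ Eventually (λ n → ∣ seq x n ℚ.- 0ℚ ∣ ℚ.< ε)}
  ...   | no ∄ε = ⊥-elim (x≄0 λ ε 0<ε → decidable-stable em λ ¬ev → ∄ε (ε , 0<ε , ¬ev))
  ...   | yes (ε , 0<ε , ¬ev) with cauchy x (½ ℚ.* ε) (ε/2 0<ε)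
  ...     | N , near with em {∃[ n ] N ℕ.≤ n × ε ℚ.≤ ∣ seq x n ℚ.- 0ℚ ∣}
  ...       | no ∄n = ⊥-elim (¬ev (N , λ n N≤n → ℚ.≰⇒> λ le → ∄n (n , N≤n , le)))
  ...       | yes (n , N≤n , ε≤∣xₙ∣) = inj₂ (
    [ (λ eq → inj₁ (½ ℚ.* ε , ε/2 0<ε , N , λ m N≤m →
        <-shift (ℚ.- (½ ℚ.* ε))
          (ℚ.≤-<-trans (ℚ.≤-trans ε≤∣xₙ∣ (ℚ.≤-reflexive (≡.trans eq (ℚ.+-identityʳ (seq x n)))))
            (∣p-q∣<ε⇒p<q+ε {seq x n} {seq x m} (near n m N≤n N≤m)))
          (solve 1 (λ ε → con 0ℚ :+ con ½ :* ε := ε :- con ½ :* ε) refl ε)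
          (solve 2 (λ x ε → x := x :+ ε :- ε) refl (seq x m) (½ ℚ.* ε))))
    , (λ eq → inj₂ (½ ℚ.* ε , ε/2 0<ε , N , λ m N≤m →
        ℚ.<-≤-trans
          (<-shift (½ ℚ.* ε) (∣p-q∣<ε⇒q<p+ε {seq x n} {seq x m} (near n m N≤n N≤m)) refl
            (solve 2 (λ x ε → x :+ ε := x :+ con ½ :* ε :+ con ½ :* ε) refl (seq x n) ε))
          (subst (seq x n ℚ.+ ε ℚ.≤_)
            (solve 1 (λ x → x :+ :- (x :- con 0ℚ) := con 0ℚ) refl (seq x n))
            (ℚ.+-monoʳ-≤ (seq x n) (ℚ.≤-trans ε≤∣xₙ∣ (ℚ.≤-reflexive eq)))))) ]′
    (ℚ.∣p∣≡p∨∣p∣≡-p (seq x n ℚ.- 0ℚ)))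

  trichotomy : ∀ x y → x ≃ y ⊎ x < y ⊎ y < x
  trichotomy x y = Sum.map equal (Sum.map less greater) (sign (y - x))
    where
    equal : y - x ≃ 0ℝ → x ≃ y
    equal y-x≃0 ε 0<ε = y-x≃0 ε 0<ε ⟨&⟩ λ n → subst (ℚ._< ε)
      (≡.trans (≡.sym (ℚ.∣-p∣≡∣p∣ (seq y n ℚ.- seq x n ℚ.- 0ℚ))) (cong ∣_∣
        (solve 2 (λ x y → :- (y :- x :- con 0ℚ) := x :- y) refl (seq x n) (seq y n))))

    less : 0ℝ < y - x → x < y
    less (η , 0<η , ev) = η , 0<η , (ev ⟨&⟩ λ n lt → <-shift (seq x n) lt
      (solve 2 (λ x η → x :+ η := con 0ℚ :+ η :+ x) refl (seq x n) η)
      (solve 2 (λ x y → y := y :- x :+ x) refl (seq x n) (seq y n)))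

    greater : y - x < 0ℝ → y < x
    greater (η , 0<η , ev) = η , 0<η , (ev ⟨&⟩ λ n lt → <-shift (seq x n) lt
      (solve 3 (λ x y η → y :+ η := y :- x :+ η :+ x) refl (seq x n) (seq y n) η)
      (≡.sym (ℚ.+-identityˡ (seq x n))))

  apart : ∀ {x} → ¬ x ≃ 0ℝ → ∃[ η ] 0ℚ ℚ.< η × Eventually λ n → η ℚ.< ∣ seq x n ∣
  apart {x} x≄0 with sign x
  ... | inj₁ x≃0 = ⊥-elim (x≄0 x≃0)
  ... | inj₂ (inj₁ (η , 0<η , ev)) = η , 0<η , (ev ⟨&⟩ λ n lt →
        ℚ.<-≤-trans (subst (ℚ._< seq x n) (ℚ.+-identityˡ η) lt) (p≤∣p∣ (seq x n)))
  ... | inj₂ (inj₂ (η , 0<η , ev)) = η , 0<η , (ev ⟨&⟩ λ n lt →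
        ℚ.<-≤-trans
          (<-shift (ℚ.- seq x n) lt (solve 2 (λ x η → η := x :+ η :- x) refl (seq x n) η)
            (≡.sym (ℚ.+-identityˡ (ℚ.- seq x n))))
          (subst (ℚ.- seq x n ℚ.≤_) (ℚ.∣-p∣≡∣p∣ (seq x n)) (p≤∣p∣ (ℚ.- seq x n))))

  0*x≃0 : ∀ x → 0ℝ * x ≃ 0ℝ
  0*x≃0 x = pointwise {0ℝ * x} {0ℝ} λ n → ℚ.*-zeroˡ (seq x n)

  -- A nonnegative real may have slightly negative terms, so the factors are first reduced by `sign`
  -- to being zero or eventually bounded below by a positive rational.
  *-nonNeg-ℝ : ∀ {x y} → 0ℝ ≤ x → 0ℝ ≤ y → 0ℝ ≤ x * y
  *-nonNeg-ℝ {x} {y} 0≤x 0≤y with sign x | sign y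
  ... | inj₁ x≃0 | _ = ≤-refl-≃ {0ℝ} {x * y} (≃-sym {x * y} {0ℝ}
        (≃-trans {x * y} {0ℝ * y} {0ℝ} (*-cong {x} {0ℝ} {y} {y} x≃0 (≃-refl {y})) (0*x≃0 y)))
  ... | inj₂ (inj₂ x<0) | _ = ⊥-elim (<⇒≱-ℝ {x} {0ℝ} x<0 0≤x)
  ... | inj₂ (inj₁ _) | inj₁ y≃0 = ≤-refl-≃ {0ℝ} {x * y} (≃-sym {x * y} {0ℝ}
        (≃-trans {x * y} {x * 0ℝ} {0ℝ} (*-cong {x} {x} {y} {0ℝ} (≃-refl {x}) y≃0)
          (pointwise {x * 0ℝ} {0ℝ} λ n → ℚ.*-zeroʳ (seq x n))))
  ... | inj₂ (inj₁ _) | inj₂ (inj₂ y<0) = ⊥-elim (<⇒≱-ℝ {y} {0ℝ} y<0 0≤y)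
  ... | inj₂ (inj₁ (η , 0<η , ev)) | inj₂ (inj₁ (θ , 0<θ , ev′)) = λ ε 0<ε →
        ev & ev′ ⟨&⟩ λ n (η<x , θ<y) →
          ℚ.<-trans (pos-* (ℚ.<-trans (p<p+ε 0ℚ 0<η) η<x) (ℚ.<-trans (p<p+ε 0ℚ 0<θ) θ<y))
                    (p<p+ε (seq x n ℚ.* seq y n) 0<ε)

  -- If both factors are nonzero, their terms eventually exceed some `η` and `θ` in absolute value,
  -- so the product cannot come within `η θ` of zero.
  integral-ℝ : ∀ {x y} → x * y ≃ 0ℝ → x ≃ 0ℝ ⊎ y ≃ 0ℝ
  integral-ℝ {x} {y} xy≃0 with em {x ≃ 0ℝ} | em {y ≃ 0ℝ}
  ... | yes x≃0 | _       = inj₁ x≃0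
  ... | no _    | yes y≃0 = inj₂ y≃0
  ... | no x≄0  | no y≄0  =
    let η , 0<η , ev  = apart {x} x≄0
        θ , 0<θ , ev′ = apart {y} y≄0
    in ⊥-elim (never (ev & ev′ & xy≃0 (η ℚ.* θ) (pos-* 0<η 0<θ)) λ n (η< , θ< , <ηθ) →
      ℚ.<-irrefl refl (ℚ.<-trans (ℚ.<-trans
        (ℚ.*-monoʳ-<-pos η {{ℚ.positive 0<η}} θ<)
        (ℚ.*-monoˡ-<-pos ∣ seq y n ∣ {{ℚ.positive (ℚ.<-trans 0<θ θ<)}} η<))
        (subst (ℚ._< η ℚ.* θ)
          (≡.trans (cong ∣_∣ (ℚ.+-identityʳ (seq x n ℚ.* seq y n)))
            (ℚ.∣p*q∣≡∣p∣*∣q∣ (seq x n) (seq y n))) <ηθ)))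

  archimedean-ℝ : ∀ {x b} → (∀ n → fromℚ (fromℕ n) * x ≤ b) → x ≤ 0ℝ
  archimedean-ℝ {x} {b} bound with sign x
  ... | inj₁ x≃0 = ≤-refl-≃ {x} {0ℝ} x≃0
  ... | inj₂ (inj₂ x<0) = <⇒≤-ℝ {x} {0ℝ} x<0
  ... | inj₂ (inj₁ (η , 0<η , ev)) =
    let N , near = cauchy b 1ℚ 0<1
        -- One unit covers the variation of `b` after index `N`, the other is the tolerance 1 at
        -- which the bound on `n x` is used.
        M = seq b N ℚ.+ 1ℚ ℚ.+ 1ℚ
        n , M≤nη = natMultipleAbove M 0<η
    in ⊥-elim (never (ev & bound n 1ℚ 0<1 & (N , λ m N≤m → near m N N≤m ℕ.≤-refl))
      λ m (η<x , nx<b+1 , near) → ℚ.<-irrefl refl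
        (ℚ.<-≤-trans (ℚ.<-trans nx<b+1
            (ℚ.+-monoˡ-< 1ℚ (∣p-q∣<ε⇒p<q+ε {seq b m} {seq b N} near)))
          (ℚ.≤-trans M≤nη (ℚ.*-monoˡ-≤-nonNeg (fromℕ n) {{ℚ.nonNegative (fromℕ-nonNeg n)}}
            (ℚ.<⇒≤ (subst (ℚ._< seq x m) (ℚ.+-identityˡ η) η<x))))))
    where
    0<1 : 0ℚ ℚ.< 1ℚ
    0<1 = ℚ.positive⁻¹ 1ℚ

  total-ℝ : ∀ x y → x ≤ y ⊎ y ≤ x
  total-ℝ x y =
    [ inj₁ ∘ ≤-refl-≃ {x} {y} , Sum.map (<⇒≤-ℝ {x} {y}) (<⇒≤-ℝ {y} {x}) ]′ (trichotomy x y)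

-- The ring and order structure of the reals.

ℝ-commutativeRing : CommutativeRing 0ℓ 0ℓ
ℝ-commutativeRing = record
  { Carrier = ℝ ; _≈_ = _≃_ ; _+_ = _+_ ; _*_ = _*_ ; -_ = -_ ; 0# = 0ℝ ; 1# = 1ℝ
  ; isCommutativeRing = record
    { isRing = record
      { +-isAbelianGroup = record
        { isGroup = record
          { isMonoid = record
            { isSemigroup = record
              { isMagma = record
                { isEquivalence = record
                  { refl  = λ {x} → ≃-refl {x}
                  ; sym   = λ {x} {y} → ≃-sym {x} {y}
                  ; trans = λ {x} {y} {z} → ≃-trans {x} {y} {z}
                  }
                ; ∙-cong = λ {x} {x′} {y} {y′} → +-cong {x} {x′} {y} {y′}
                }
              ; assoc = λ x y z → pointwise {x + y + z} {x + (y + z)} λ n →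
                  ℚ.+-assoc (seq x n) (seq y n) (seq z n)
              }
            ; identity =
                (λ x → pointwise {0ℝ + x} {x} λ n → ℚ.+-identityˡ (seq x n)) ,
                (λ x → pointwise {x + 0ℝ} {x} λ n → ℚ.+-identityʳ (seq x n))
            }
          ; inverse =
              (λ x → pointwise { - x + x} {0ℝ} λ n → ℚ.+-inverseˡ (seq x n)) ,
              (λ x → pointwise {x - x} {0ℝ} λ n → ℚ.+-inverseʳ (seq x n))
          ; ⁻¹-cong = λ {x} {y} → -‿cong {x} {y}
          }
        ; comm = λ x y → pointwise {x + y} {y + x} λ n → ℚ.+-comm (seq x n) (seq y n)
        }
      ; *-cong = λ {x} {x′} {y} {y′} → *-cong {x} {x′} {y} {y′}
      ; *-assoc = λ x y z → pointwise {x * y * z} {x * (y * z)} λ n →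
          ℚ.*-assoc (seq x n) (seq y n) (seq z n)
      ; *-identity =
          (λ x → pointwise {1ℝ * x} {x} λ n → ℚ.*-identityˡ (seq x n)) ,
          (λ x → pointwise {x * 1ℝ} {x} λ n → ℚ.*-identityʳ (seq x n))
      ; distrib =
          (λ x y z → pointwise {x * (y + z)} {x * y + x * z} λ n →
            ℚ.*-distribˡ-+ (seq x n) (seq y n) (seq z n)) ,
          (λ x y z → pointwise {(y + z) * x} {y * x + z * x} λ n →
            ℚ.*-distribʳ-+ (seq x n) (seq y n) (seq z n))
      }
    ; *-comm = λ x y → pointwise {x * y} {y * x} λ n → ℚ.*-comm (seq x n) (seq y n)
    }
  }

ℝ-archimedeanDomain : ExcludedMiddle 0ℓ → ArchimedeanDomain
ℝ-archimedeanDomain em = record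
  { commutativeRing = ℝ-commutativeRing
  ; morphism = record
    { ⟦_⟧    = fromℚ
    ; +-homo = λ p q → pointwise {fromℚ (p ℚ.+ q)} {fromℚ p + fromℚ q} λ _ → refl
    ; *-homo = λ p q → pointwise {fromℚ (p ℚ.* q)} {fromℚ p * fromℚ q} λ _ → refl
    ; -‿homo = λ p → pointwise {fromℚ (ℚ.- p)} { - fromℚ p} λ _ → refl
    ; 0-homo = ≃-refl {0ℝ}
    ; 1-homo = ≃-refl {1ℝ}
    }
  ; _≤_ = _≤_
  ; isTotalOrder = record
    { isPartialOrder = record
      { isPreorder = record
        { isEquivalence = CommutativeRing.isEquivalence ℝ-commutativeRing
        ; reflexive = λ {x} {y} → ≤-refl-≃ {x} {y}
        ; trans = λ {x} {y} {z} → ≤-trans-ℝ {x} {y} {z}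
        }
      ; antisym = λ {x} {y} → ≤-antisym-ℝ {x} {y}
      }
    ; total = total-ℝ em
    }
  ; +-monoʳ-≤ = λ z {x} {y} → +-monoʳ-≤-ℝ z {x} {y}
  ; *-nonNeg = λ {x} {y} → *-nonNeg-ℝ em {x} {y}
  ; integral = λ {x} {y} → integral-ℝ em {x} {y}
  ; ι-mono = fromℚ-mono
  ; ι-cancel = fromℚ-cancel
  ; archimedean = λ {x} {b} → archimedean-ℝ em {x} {b}
  }

-- Isomorphisms between the graphs of strips.

noNarrowerIsomorph : ExcludedMiddle 0ℓ → ∀ {ε₁ ε₂} → 0ℝ < ε₂ → ε₂ < ε₁ →
  ¬ (unitDistanceGraph (strip ε₁) ≅ unitDistanceGraph (strip ε₂))
noNarrowerIsomorph em {ε₁} {ε₂} 0<ε₂ ε₂<ε₁ iso =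
  let δ , 0<δ , gap = <⇒gap {ε₂} {ε₁} ε₂<ε₁
  in noStripEmbedding em {ε₁} {ε₂} {δ} (<⇒≤-ℝ {0ℝ} {ε₂} 0<ε₂) 0<δ gap
    to (λ {p} {q} → to-cong {p} {q})
    (λ {p} {q} unit → distance⇒unit {proj₁ (to p)} {proj₁ (to q)}
      (Equivalence.to (adjacent p q) (unit⇒distance {proj₁ p} {proj₁ q} unit)))
    (λ {p} {q} → Injection.injective (Inverse.Inverse⇒Injection bijection) {p} {q})
  where
  open _≅_ iso
  open Strips (ℝ-archimedeanDomain em) using (noStripEmbedding; Unit)

  1*1≃1 : 1ℝ * 1ℝ ≃ 1ℝ
  1*1≃1 = pointwise {1ℝ * 1ℝ} {1ℝ} λ _ → refl

  unit⇒distance : ∀ {p q} → Unit p q → Distance p q 1ℝ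
  unit⇒distance {p} {q} unit = fromℚ-mono (ℚ.nonNegative⁻¹ 1ℚ) ,
    ≃-trans {1ℝ * 1ℝ} {1ℝ} {Δ² p q} 1*1≃1 (≃-sym {Δ² p q} {1ℝ} unit)

  distance⇒unit : ∀ {p q} → Distance p q 1ℝ → Unit p q
  distance⇒unit {p} {q} (_ , eq) =
    ≃-trans {Δ² p q} {1ℝ * 1ℝ} {1ℝ} (≃-sym {1ℝ * 1ℝ} {Δ² p q} eq) 1*1≃1

strip-resp : ∀ {ε₁ ε₂} → ε₁ ≃ ε₂ → ∀ p → strip ε₁ p → strip ε₂ p
strip-resp {ε₁} {ε₂} ε₁≃ε₂ (x , y) (0≤y , y≤ε₁) =
  0≤y , ≤-trans-ℝ {y} {ε₁} {ε₂} y≤ε₁ (≤-refl-≃ {ε₁} {ε₂} ε₁≃ε₂)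

-- The identity on points: strips of equal width differ only in the membership proofs.
≃⇒≅ : ∀ {ε₁ ε₂} → ε₁ ≃ ε₂ → unitDistanceGraph (strip ε₁) ≅ unitDistanceGraph (strip ε₂)
≃⇒≅ {ε₁} {ε₂} ε₁≃ε₂ = record
  { bijection = record
    { to        = λ (p , p∈) → p , strip-resp {ε₁} {ε₂} ε₁≃ε₂ p p∈
    ; from      = λ (p , p∈) → p , strip-resp {ε₂} {ε₁} (≃-sym {ε₁} {ε₂} ε₁≃ε₂) p p∈
    ; to-cong   = id
    ; from-cong = id
    ; inverse   = id , id
    }
  ; adjacent = λ _ _ → mk⇔ id id
  }

≅-sym : ∀ {G H : Graph 0ℓ 0ℓ 0ℓ} → G ≅ H → H ≅ G
≅-sym {G} {H} iso = record
  { bijection = Inverse.sym bijection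
  ; adjacent  = λ u v → mk⇔
      (Equivalence.from (adjacent (from u) (from v)) ∘
        proj₂ H.resp (H.sym (strictlyInverseˡ u)) ∘ proj₁ H.resp (H.sym (strictlyInverseˡ v)))
      (proj₂ H.resp (strictlyInverseˡ u) ∘ proj₁ H.resp (strictlyInverseˡ v) ∘
        Equivalence.to (adjacent (from u) (from v)))
  }
  where
  open _≅_ iso
  module H where
    open Graph H public
    open Setoid vertices public using (sym)

theorem1 : ExcludedMiddle 0ℓ →
    (ε₁ ε₂ : ℝ) → 0ℝ < ε₁ → 0ℝ < ε₂ →
    (unitDistanceGraph (strip ε₁) ≅ unitDistanceGraph (strip ε₂)) ⇔ ε₁ ≃ ε₂
theorem1 em ε₁ ε₂ 0<ε₁ 0<ε₂ = mk⇔
  -- The wider strip has to be the domain, so the case `ε₁ < ε₂` reverses the isomorphism.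
  (λ iso → [ id
           , ⊥-elim ∘ [ (λ ε₁<ε₂ → noNarrowerIsomorph em {ε₂} {ε₁} 0<ε₁ ε₁<ε₂ (≅-sym iso))
                      , (λ ε₂<ε₁ → noNarrowerIsomorph em {ε₁} {ε₂} 0<ε₂ ε₂<ε₁ iso) ]′
           ]′ (trichotomy em ε₁ ε₂))
  (≃⇒≅ {ε₁} {ε₂})
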